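{- Assuming the Orthogonal Vectors Conjecture, for any $\epsilon>0$ there is no data structure that, given any straight-line grammar (SLG) $G$ representing a string $T\in\Sigma^{N}$, where $\Sigma=\{1,\ldots,\sigma\}$ and $\sigma=\Omega((N/\log N)^{1/2})$, answers range mode frequency queries on $T$ in $O(|G|^{1-\epsilon}\log^{O(1)}N)$ time, and takes $O(|G|^{2-\epsilon}\log^{O(1)}N)$ time to construct.
   Context: **Model and asymptotics.** Running times are in the standard word RAM model with machine words of $\Theta(\log n)$ bits ($n$ the input-size parameter), where standard arithmetic and bitwise operations take $O(1)$ time. $\log^{O(1)}N$ means $(\log N)^c$ for some constant $c$. The condition $\sigma=\Omega((N/\log N)^{1/2})$ restricts the inputs that must be handled to those with $\sigma\ge\kappa(N/\log N)^{1/2}$ for a fixed constant $\kappa>0$. **Orthogonal Vectors (OV).** Input: a set $A\subseteq\{0,1\}^d$ with $|A|=n$. Output: whether there exist $x,y\in A$ with $\langle x,y\rangle=\sum_{i=1}^d x[i]\,y[i]=0$. **Orthogonal Vectors Conjecture:** for every constant $\epsilon>0$ there exists a constant $c\ge1$ such that OV cannot be solved in $O(n^{2-\epsilon})$ time on instances with $d=c\log n$. **Straight-line grammars.** An SLG is a context-free grammar $G=(V,\Sigma,R,S)$ (nonterminals $V$, terminals $\Sigma$, $V\cap\Sigma=\emptyset$, rules $R\subseteq V\times(V\cup\Sigma)^*$, start symbol $S\in V$) such that each $N\in V$ has exactly one rule $(N,\gamma)\in R$, whose right-hand side $\gamma$ is denoted $\mathrm{rhs}_G(N)$, and there is an ordering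 $N_1,\ldots,N_{|V|}$ of $V$ with $\mathrm{rhs}_G(N_i)\in(\{N_{i+1},\ldots,N_{|V|}\}\cup\Sigma)^*$ for all $i$. Hence $G$ generates (represents) exactly one string. The size of $G$ is $|G|=\sum_{N\in V}\max(|\mathrm{rhs}_G(N)|,1)$. **Range mode frequency query.** Strings are indexed from $1$. For $T\in\Sigma^N$ and $b,e\in\{0,\ldots,N\}$, the query asks for $\mathrm{mode\text{ - }freq}_T(b,e)=\max_{c\in\Sigma}|\{i: b<i\le e,\ T[i]=c\}|$. -}

module Defs where

open import Data.Bool using (if_then_else_)
open import Data.Fin as Fin using (Fin; toℕ)
open import Data.Fin.Permutation using (Permutation′; _⟨$⟩ʳ_)
open import Data.Integer using (∣_∣)
open import Data.List using (List; []; _∷_; [_]; _++_; map; concatMap; length; filter; allFin)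
open import Data.List.Extrema.Nat using (max)
open import Data.List.Membership.Propositional using (_∈_)
open import Data.Nat
open import Data.Nat.DivMod using (_/_; _%_)
open import Data.Nat.ListAction using (sum)
open import Data.Nat.Logarithm using (⌊log₂_⌋; ⌈log₂_⌉)
open import Data.Nat.Properties using (m^n≢0)
open import Data.Product using (_×_; _,_; ∃-syntax)
open import Data.Rational as ℚ using (ℚ; 0ℚ; ↥_; ↧ₙ_)
open import Data.Sum using (_⊎_; inj₁; inj₂)
open import Data.Vec as Vec using (Vec; lookup)
open import Data.Vec.Relation.Unary.Unique.Propositional using (Unique)
open import Relation.Binary.Construct.Closure.ReflexiveTransitive using (Star)
open import Relation.Binary.PropositionalEquality using (_≡_; _≢_)
open import Relation.Nullary using (¬_; does; _×-dec_)

-- Word RAM.  Programs have structured control flow over unit-cost register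
-- instructions; jumps can be simulated by a program-counter variable at
-- constant-factor cost, since a program is a fixed finite object.  A
-- program mentions finitely many registers.  Registers and memory cells
-- hold w-bit words, represented as naturals below 2 ^ w.

word : (w : ℕ) → ℕ → ℕ
word w x = _%_ x (2 ^ w) {{m^n≢0 2 w}}

-- Applies f to each of the w lowest pairs of bits.
bitwise : (ℕ → ℕ → ℕ) → (w : ℕ) → ℕ → ℕ → ℕ
bitwise f zero    x y = 0
bitwise f (suc w) x y = f (x % 2) (y % 2) + 2 * bitwise f w (x / 2) (y / 2)

data Op : Set where
  add sub mul quo rem and or xor shl shr eq lt : Op

-- Arithmetic is modulo 2 ^ w; dividing by zero yields 0.  On single bits
-- _*_, _⊔_ and ∣_-_∣ are conjunction, disjunction and exclusive or.
⟦_⟧ : Op → (w : ℕ) → ℕ → ℕ → ℕ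
⟦ add ⟧ w x y         = word w (x + y)
⟦ sub ⟧ w x y         = word w (2 ^ w + x ∸ y)
⟦ mul ⟧ w x y         = word w (x * y)
⟦ quo ⟧ w x zero      = 0
⟦ quo ⟧ w x y@(suc _) = word w (x / y)
⟦ rem ⟧ w x zero      = 0
⟦ rem ⟧ w x y@(suc _) = word w (x % y)
⟦ and ⟧ w x y         = bitwise _*_ w x y
⟦ or  ⟧ w x y         = bitwise _⊔_ w x y
⟦ xor ⟧ w x y         = bitwise ∣_-_∣ w x y
⟦ shl ⟧ w x y         = word w (x * 2 ^ y)
⟦ shr ⟧ w x y         = word w (_/_ x (2 ^ y) {{m^n≢0 2 y}})
⟦ eq  ⟧ w x y         = word w (if does (x ≟ y) then 1 else 0)
⟦ lt  ⟧ w x y         = word w (if does (x <? y) then 1 else 0)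

Reg : Set
Reg = ℕ

data Instr : Set where
  const : Reg → ℕ → Instr             -- r ← v
  binop : Op → Reg → Reg → Reg → Instr -- r ← r₁ op r₂
  read  : Reg → Reg → Instr           -- r ← mem[a]
  write : Reg → Reg → Instr           -- mem[a] ← r

infixr 4 _⨾_

data Program : Set where
  skip  : Program
  instr : Instr → Program
  _⨾_   : Program → Program → Program
  ifnz  : Reg → Program → Program → Program
  while : Reg → Program → Program

record State : Set where
  constructor ⟨_,_⟩
  field
    reg : Reg → ℕ
    mem : ℕ → ℕ

open State public

_[_≔_] : (ℕ → ℕ) → ℕ → ℕ → (ℕ → ℕ)
(f [ i ≔ v ]) j = if does (i ≟ j) then v else f j

setReg : Reg → ℕ → State → State
setReg r v s = ⟨ reg s [ r ≔ v ] , mem s ⟩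

step : (w : ℕ) → Instr → State → State
step w (const r v)         s = setReg r (word w v) s
step w (binop op r r₁ r₂)  s = setReg r (⟦ op ⟧ w (reg s r₁) (reg s r₂)) s
step w (read r a)          s = setReg r (mem s (reg s a)) s
step w (write a r)         s = ⟨ reg s , mem s [ reg s a ≔ reg s r ] ⟩

-- Exec w P s t s′: with w-bit words, P started in s halts in s′ after t
-- steps, each instruction and each test of a condition being one step.
data Exec (w : ℕ) : Program → State → ℕ → State → Set where
  skip    : ∀ {s} → Exec w skip s 0 s
  instr   : ∀ {i s} → Exec w (instr i) s 1 (step w i s)
  seq     : ∀ {P Q s s′ s″ t t′} →
            Exec w P s t s′ → Exec w Q s′ t′ s″ → Exec w (P ⨾ Q) s (t + t′) s″
  if-yes  : ∀ {r P Q s s′ t} → reg s r ≢ 0 →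
            Exec w P s t s′ → Exec w (ifnz r P Q) s (1 + t) s′
  if-no   : ∀ {r P Q s s′ t} → reg s r ≡ 0 →
            Exec w Q s t s′ → Exec w (ifnz r P Q) s (1 + t) s′
  while-0 : ∀ {r P s} → reg s r ≡ 0 → Exec w (while r P) s 1 s
  while-s : ∀ {r P s s′ s″ t t′} → reg s r ≢ 0 →
            Exec w P s t s′ → Exec w (while r P) s′ t′ s″ →
            Exec w (while r P) s (1 + t + t′) s″

-- Entry of a list at an index, 0 beyond its end.
nth : List ℕ → ℕ → ℕ
nth []       _       = 0
nth (x ∷ xs) zero    = x
nth (x ∷ xs) (suc i) = nth xs i

-- Input words at addresses 0, 1, …; all other cells and registers are 0.
load : (w : ℕ) → List ℕ → State
load w xs = ⟨ (λ _ → 0) , (λ a → word w (nth xs a)) ⟩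

-- k times the bit length of n (1 for n = 0): Θ(log n) bits for constant k.
wordSize : (k n : ℕ) → ℕ
wordSize k n = k * suc ⌊log₂ n ⌋

-- t ≤ a · x ^ (j - ε) for ε = p / q > 0 and x ≥ 1: raised to the power q
-- and multiplied by x ^ p, which also covers a negative exponent.
_≤_·_^[_-_] : (t a x j : ℕ) (ε : ℚ) → Set
t ≤ a · x ^[ j - ε ] = t ^ q * x ^ p ≤ a ^ q * x ^ (j * q)
  where
  p = ∣ ↥ ε ∣
  q = ↧ₙ ε

⟨_∙_⟩ : ∀ {d} → Vec (Fin 2) d → Vec (Fin 2) d → ℕ
⟨ x ∙ y ⟩ = Vec.sum (Vec.zipWith (λ a b → toℕ a * toℕ b) x y)

-- The two positions may coincide.
HasOrthogonalPair : ∀ {n d} → Vec (Vec (Fin 2) d) n → Set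
HasOrthogonalPair {n} A = ∃[ i ] ∃[ j ] ⟨ lookup A i ∙ lookup A j ⟩ ≡ 0

-- One coordinate per word.
encodeOV : ∀ {n d} → Vec (Vec (Fin 2) d) n → List ℕ
encodeOV {n} {d} A =
  n ∷ d ∷ concatMap (λ x → map toℕ (Vec.toList x)) (Vec.toList A)

-- OV with d = c log n (rounded up) is solvable in O(n ^ (2 - ε)) time.
-- A set of n vectors is given as a vector without repetitions.
record OVSolvable (ε : ℚ) (c : ℕ) : Set where
  field
    program  : Program
    k C n₀   : ℕ
    solves   : ∀ n (A : Vec (Vec (Fin 2) (c * ⌈log₂ n ⌉)) n) → Unique A →
               let w = wordSize k n in
               ∃[ t ] ∃[ s ]
                 Exec w program (load w (encodeOV A)) t s
               × (HasOrthogonalPair A → reg s 0 ≡ 1)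
               × (¬ HasOrthogonalPair A → reg s 0 ≡ 0)
               × (n₀ ≤ n → t ≤ C · n ^[ 2 - ε ])

OrthogonalVectorsConjecture : Set
OrthogonalVectorsConjecture =
  (ε : ℚ) → 0ℚ ℚ.< ε → ∃[ c ] 1 ≤ c × ¬ OVSolvable ε c

-- Over Σ = {1, …, σ}; the letter c : Fin σ stands for suc (toℕ c).
record SLG (σ : ℕ) : Set where
  field
    numNT   : ℕ
    rhs     : Fin numNT → List (Fin numNT ⊎ Fin σ)
    start   : Fin numNT
    order   : Permutation′ numNT
    ordered : ∀ A B → inj₁ B ∈ rhs A → (order ⟨$⟩ʳ A) Fin.< (order ⟨$⟩ʳ B)

  Symbol : Set
  Symbol = Fin numNT ⊎ Fin σ

  data _⇒_ : List Symbol → List Symbol → Set where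
    rewriteNT : ∀ α A β → (α ++ inj₁ A ∷ β) ⇒ (α ++ rhs A ++ β)

  Represents : ∀ {N} → Vec (Fin σ) N → Set
  Represents T = Star _⇒_ [ inj₁ start ] (map inj₂ (Vec.toList T))

  size : ℕ
  size = sum (map (λ A → length (rhs A) ⊔ 1) (allFin numNT))

  encodeSymbol : Symbol → List ℕ
  encodeSymbol (inj₁ A) = 0 ∷ toℕ A ∷ []
  encodeSymbol (inj₂ c) = 1 ∷ suc (toℕ c) ∷ []

  encode : List ℕ
  encode = σ ∷ numNT ∷ toℕ start ∷
           concatMap (λ A → length (rhs A) ∷ concatMap encodeSymbol (rhs A))
                     (allFin numNT)

-- |{ i : b < i ≤ e, T[i] = c }|, with T[suc (toℕ i)] = lookup T i.
occ : ∀ {σ N} → Vec (Fin σ) N → (b e : ℕ) → Fin σ → ℕ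
occ {N = N} T b e c =
  length (filter (λ i → b <? suc (toℕ i) ×-dec suc (toℕ i) ≤? e
                        ×-dec lookup T i Fin.≟ c)
                 (allFin N))

modeFreq : ∀ {σ N} → Vec (Fin σ) N → (b e : ℕ) → ℕ
modeFreq {σ} T b e = max 0 (map (occ T b e) (allFin σ))

-- σ ≥ κ (N / log N)^(1/2), squared and cleared of denominators.  Rounding
-- log N changes κ by a constant factor only.
LargeAlphabet : (κ : ℚ) (σ N : ℕ) → Set
LargeAlphabet κ σ N = a ^ 2 * N ≤ b ^ 2 * σ ^ 2 * ⌊log₂ N ⌋
  where
  a = ∣ ↥ κ ∣
  b = ↧ₙ κ

ask : (w b e : ℕ) → State → State
ask w b e s = setReg 1 (word w e) (setReg 0 (word w b) s)

-- The states a data structure can be in: right after construction, and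
-- after any sequence of queries.
data Reachable (w N : ℕ) (build query : Program) (input : List ℕ) : State → Set where
  built   : ∀ {t s} → Exec w build (load w input) t s →
            Reachable w N build query input s
  queried : ∀ {b e t s s′} → Reachable w N build query input s → b ≤ N → e ≤ N →
            Exec w query (ask w b e s) t s′ →
            Reachable w N build query input s′

-- The input-size parameter is |G| + N + σ, so that addresses of the input,
-- positions in T and letters all fit in a word.  It is N^Θ(1) unless |G| or
-- σ is superpolynomial in N.
record ModeFreqDataStructure (ε κ : ℚ) : Set where
  field
    build query  : Program
    k            : ℕ
    Cb cb Cq cq  : ℕ
    N₀           : ℕ
    correct      :
      ∀ {σ N} (G : SLG σ) (T : Vec (Fin σ) N) →
      SLG.Represents G T → LargeAlphabet κ σ N →
      let |G| = SLG.size G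
          w   = wordSize k (|G| + N + σ)
          x   = SLG.encode G
      in
      (∃[ t ] ∃[ s ]
         Exec w build (load w x) t s
       × (N₀ ≤ N → t ≤ Cb * ⌊log₂ N ⌋ ^ cb · |G| ^[ 2 - ε ]))
      ×
      (∀ s → Reachable w N build query x s → ∀ b e → b ≤ N → e ≤ N →
       ∃[ t ] ∃[ s′ ]
         Exec w query (ask w b e s) t s′
       × reg s′ 0 ≡ modeFreq T b e
       × (N₀ ≤ N → t ≤ Cq * ⌊log₂ N ⌋ ^ cq · |G| ^[ 1 - ε ]))

{-# OPTIONS --safe #-}

-- Given n vectors of dimension d, extended by a coordinate 0 that vanishes,
-- let S k (k ≤ d) be the string of length n whose j-th letter is j if vector j
-- has a 0 in coordinate k, and a letter reserved for the pair (j, k)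
-- otherwise.  Let B i be the concatenation over k of S k where vector i has a 1
-- in coordinate k, and of S 0 where it has a 0.  In B i the letter j occurs
-- d + 1 − ⟨xᵢ, xⱼ⟩ times, and no letter outside S 0 occurs more than d times.
-- So the mode of B i has frequency d + 1 if and only if vector i is orthogonal
-- to some vector.  The text B 0 B 1 … has a grammar of size O(n d), and n
-- queries decide OV.
--
-- The word size of the data structure is a multiple of the bit length of
-- |G| + N + σ, that of the OV algorithm a multiple of the bit length of n.
-- Unused letters cost nothing, so σ can be taken so large, n p ^ e with p the
-- least power of 2 above n, that the two word sizes coincide.  Then the
-- programs of the data structure run unchanged, up to a renaming of registers.

module Submission where

open import Defs
open import Data.Bool using (Bool; true; false; if_then_else_; _∧_)
open import Data.Fin as Fin using (Fin; zero; suc; toℕ; fromℕ<; _↑ˡ_; _↑ʳ_; splitAt)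
import Data.Fin.Permutation as Permutation
open import Data.Fin.Properties
  using (toℕ<n; toℕ-injective; toℕ-fromℕ<; toℕ-↑ˡ; toℕ-↑ʳ; splitAt-↑ˡ; splitAt-↑ʳ; splitAt⁻¹-↑ˡ)
open import Data.Integer as ℤ using (∣_∣)
open import Data.List using (List; []; _∷_; [_]; _++_; map; concat; concatMap; length; filter; tabulate; allFin)
open import Data.List.Extrema.Nat using (argmax-sel; v≤max⁺)
open import Data.List.Membership.Propositional using (_∈_; lose)
open import Data.List.Membership.Propositional.Properties using (∈-tabulate⁻; ∈-map⁻; ∈-map⁺; ∈-allFin)
open import Data.List.Properties
  using (++-assoc; ++-identityʳ; length-++; map-++; map-tabulate; length-tabulate)
open import Data.List.Relation.Unary.All as All using (All)
open import Data.List.Relation.Unary.All.Properties using (++⁺)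
open import Data.Nat
open import Data.Nat.Coprimality using (1-coprimeTo)
open import Data.Nat.DivMod using (_/_; _%_; m<n⇒m%n≡m; [m+n]%n≡m%n; n%1≡0; m≡m%n+[m/n]*n; m%n<n; m/n*n≤m)
open import Data.Nat.ListAction using (sum)
open import Data.Nat.Logarithm
open import Data.Nat.Properties
open import Data.Nat.Tactic.RingSolver using (solve-∀)
open import Data.Product using (_×_; _,_; ∃-syntax; proj₁; proj₂)
open import Data.Rational as ℚ using (ℚ; mkℚ; 0ℚ; ↥_; ↧ₙ_)
open import Data.Rational.Properties using (positive⁻¹)
open import Data.Sum using (_⊎_; inj₁; inj₂)
open import Data.Unit using (tt)
open import Data.Vec as Vec using (Vec; []; _∷_; lookup)
open import Data.Vec.Properties using (toList∘fromList)
open import Function using (_∘_; case_of_; id)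
open import Relation.Binary.Construct.Closure.ReflexiveTransitive
  using (Star; _◅_; _◅◅_) renaming (ε to nil)
open import Relation.Binary.PropositionalEquality hiding ([_])
open import Relation.Nullary using (Dec; ¬_; yes; no; does; contradiction; _×-dec_)
open import Relation.Nullary.Decidable using (True; toWitness; dec-true; dec-false)
open import Relation.Unary using (Decidable)

-- Two constraints shape the construction. Arithmetic is modulo 2 ^ w, so a program is sure to
-- behave the same only under exactly the same word size, not under one of the same order. Hence σ
-- is tuned until the bit length of |G| + N + σ is exactly e + 1 times that of n; the summands |G| +
-- N cannot disturb this, as they stay below p ^ e. Moreover, the data structure expects the
-- encoding of the grammar from address 0 on with zeros behind it, which is where the vectors lie.
-- They are moved to address σ, beyond the end of the encoding, and erased once the encoding is
-- written. As for time, |G| is O(n log n). If ε has denominator q, the construction and the n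
-- queries each save at least a factor n ^ (1 / q) over n ^ 2, up to logarithms. Half of the
-- exponent saved pays for the logarithms, which leaves the exponent 2 - 1 / (2 q) for OV.

-- Time-bounded total correctness of word RAM programs

record Runs (w : ℕ) (P : Program) (s : State) (T : ℕ) (Q : State → Set) : Set where
  constructor runs
  field
    {time}  : ℕ
    {final} : State
    exec    : Exec w P s time final
    time≤   : time ≤ T
    post    : Q final

module _ {w : ℕ} where

  word-< : ∀ {x} → x < 2 ^ w → word w x ≡ x
  word-< = m<n⇒m%n≡m {{m^n≢0 2 w}}

  0<2^w : 0 < 2 ^ w
  0<2^w = m^n>0 2 w

  runs-mono : ∀ {P s T T′} {Q R : State → Set} → T ≤ T′ → (∀ s′ → Q s′ → R s′) →
              Runs w P s T Q → Runs w P s T′ R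
  runs-mono T≤ Q⇒R (runs e t≤ q) = runs e (≤-trans t≤ T≤) (Q⇒R _ q)

  do-skip : ∀ {s T} {Q : State → Set} → Q s → Runs w skip s T Q
  do-skip q = runs skip z≤n q

  do-seq : ∀ {P P′ s T T′} {Q R : State → Set} → Runs w P s T Q →
           (∀ s′ → Q s′ → Runs w P′ s′ T′ R) → Runs w (P ⨾ P′) s (T + T′) R
  do-seq (runs e t≤ q) f with f _ q
  ... | runs e′ t′≤ r = runs (seq e e′) (+-mono-≤ t≤ t′≤) r

  module _ {P : Program} {s : State} {T : ℕ} {Q : State → Set} where

    -- This rule and those below execute a program forwards on a symbolic state: the continuation is
    -- checked in the updated state, where lookups of numeral registers reduce.
    do-instr : ∀ {i s′} → step w i s ≡ s′ → Runs w P s′ T Q → Runs w (instr i ⨾ P) s (suc T) Q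
    do-instr refl (runs e t≤ q) = runs (seq instr e) (s≤s t≤) q

    do-const : ∀ {r v} → v < 2 ^ w → Runs w P (setReg r v s) T Q →
               Runs w (instr (const r v) ⨾ P) s (suc T) Q
    do-const {r} v< = do-instr (cong (λ v → setReg r v s) (word-< v<))

    do-binop : ∀ {o r r₁ r₂ v} → ⟦ o ⟧ w (reg s r₁) (reg s r₂) ≡ v → Runs w P (setReg r v s) T Q →
               Runs w (instr (binop o r r₁ r₂) ⨾ P) s (suc T) Q
    do-binop {r = r} p = do-instr (cong (λ v → setReg r v s) p)

    do-add : ∀ {r r₁ r₂ x y} → reg s r₁ ≡ x → reg s r₂ ≡ y → x + y < 2 ^ w →
             Runs w P (setReg r (x + y) s) T Q →
             Runs w (instr (binop add r r₁ r₂) ⨾ P) s (suc T) Q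
    do-add refl refl < = do-binop (word-< <)

    do-mul : ∀ {r r₁ r₂ x y} → reg s r₁ ≡ x → reg s r₂ ≡ y → x * y < 2 ^ w →
             Runs w P (setReg r (x * y) s) T Q →
             Runs w (instr (binop mul r r₁ r₂) ⨾ P) s (suc T) Q
    do-mul refl refl < = do-binop (word-< <)

    do-pred : ∀ {r r₁ r₂ x} → reg s r₁ ≡ suc x → reg s r₂ ≡ 1 → x < 2 ^ w →
              Runs w P (setReg r x s) T Q →
              Runs w (instr (binop sub r r₁ r₂) ⨾ P) s (suc T) Q
    do-pred {x = x} eq₁ eq₂ < = do-binop (begin
      word w (2 ^ w + reg s _ ∸ reg s _)  ≡⟨ cong₂ (λ a b → word w (2 ^ w + a ∸ b)) eq₁ eq₂ ⟩
      word w (2 ^ w + suc x ∸ 1)          ≡⟨ cong (λ a → word w (a ∸ 1)) (+-suc (2 ^ w) x) ⟩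
      word w (2 ^ w + x)                  ≡⟨ cong (word w) (+-comm (2 ^ w) x) ⟩
      word w (x + 2 ^ w)                  ≡⟨ [m+n]%n≡m%n x (2 ^ w) {{m^n≢0 2 w}} ⟩
      word w x                            ≡⟨ word-< < ⟩
      x                                   ∎)
      where open ≡-Reasoning

    -- The outcome is handed on as a variable with its two possible meanings, which keeps the
    -- unevaluated comparison out of the symbolic state.
    do-lt : ∀ {r r₁ r₂ x y} → reg s r₁ ≡ x → reg s r₂ ≡ y → 1 < 2 ^ w →
            (∀ v → (v ≡ 1 × x < y) ⊎ (v ≡ 0 × y ≤ x) → Runs w P (setReg r v s) T Q) →
            Runs w (instr (binop lt r r₁ r₂) ⨾ P) s (suc T) Q
    do-lt {x = x} {y} refl refl 1< run = do-instr refl (run _ test)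
      where
      test : ⟦ lt ⟧ w x y ≡ 1 × x < y ⊎ ⟦ lt ⟧ w x y ≡ 0 × y ≤ x
      test with x <? y
      ... | yes x<y = inj₁ (trans (cong (λ b → word w (if b then 1 else 0)) (dec-true (x <? y) x<y)) (word-< 1<) , x<y)
      ... | no x≮y  = inj₂ (trans (cong (λ b → word w (if b then 1 else 0)) (dec-false (x <? y) x≮y)) (word-< 0<2^w) , ≮⇒≥ x≮y)

    do-read : ∀ {r a x v} → reg s a ≡ x → mem s x ≡ v → Runs w P (setReg r v s) T Q →
              Runs w (instr (read r a) ⨾ P) s (suc T) Q
    do-read {r} refl p = do-instr (cong (λ v → setReg r v s) p)

    do-write : ∀ {r a x v} → reg s a ≡ x → reg s r ≡ v →
               Runs w P ⟨ reg s , mem s [ x ≔ v ] ⟩ T Q →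
               Runs w (instr (write a r) ⨾ P) s (suc T) Q
    do-write refl refl = do-instr refl

  -- The iterations need not share a time bound known in advance: any property
  -- of the individual bounds is inherited by their maximum.
  do-while′ : (I : ℕ → State → Set) (Good : ℕ → Set) {c : Reg} {body : Program} {T₀ : ℕ} → Good T₀ →
              (∀ j s → I j s → reg s c ≡ j) →
              (∀ j s → I (suc j) s → ∃[ T ] Good T × Runs w body s T (I j)) →
              ∀ j s → I j s → ∃[ T ] Good T × Runs w (while c body) s (1 + j * (1 + T)) (I 0)
  do-while′ I Good good₀ counter run zero s i =
    _ , good₀ , runs (while-0 (counter 0 s i)) ≤-refl i
  do-while′ I Good good₀ counter run (suc j) s i
    with T , good , runs e t≤ i′ ← run j s i
    with T′ , good′ , runs e′ t′≤ i″ ← do-while′ I Good good₀ counter run j _ i′ =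
    T ⊔ T′ , good-⊔ ,
    runs (while-s nonzero e e′)
         (s≤s (≤-trans (+-mono-≤ t≤ (≤-trans t′≤ (s≤s (*-monoʳ-≤ j (s≤s (m≤n⊔m T T′))))))
              (≤-trans (+-monoˡ-≤ _ (m≤m⊔n T T′)) (≤-reflexive (+-suc (T ⊔ T′) _)))))
         i″
    where
    nonzero : reg s _ ≢ 0
    nonzero p with () ← trans (sym p) (counter (suc j) s i)
    good-⊔ : Good (T ⊔ T′)
    good-⊔ with ⊔-sel T T′
    ... | inj₁ p = subst Good (sym p) good
    ... | inj₂ p = subst Good (sym p) good′

  do-while : (I : ℕ → State → Set) {c : Reg} {body : Program} (T : ℕ) →
             (∀ j s → I j s → reg s c ≡ j) →
             (∀ j s → I (suc j) s → Runs w body s T (I j)) →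
             ∀ j s → I j s → Runs w (while c body) s (1 + j * (1 + T)) (I 0)
  do-while I T counter run j s i
    with T′ , T′≤ , r ← do-while′ I (_≤ T) {T₀ = 0} z≤n counter
                          (λ j s i → T , ≤-refl , run j s i) j s i =
    runs-mono (s≤s (*-monoʳ-≤ j (s≤s T′≤))) (λ _ i → i) r

-- Relocating the registers of a program

-- Programs of the data structure get the registers from 20 on, so that
-- lookups in the remaining ones compute.

offset : ℕ
offset = 20

shiftInstr : Instr → Instr
shiftInstr (const r v)        = const (offset + r) v
shiftInstr (binop o r r₁ r₂)  = binop o (offset + r) (offset + r₁) (offset + r₂)
shiftInstr (read r a)         = read (offset + r) (offset + a)
shiftInstr (write a r)        = write (offset + a) (offset + r)

shift : Program → Program
shift skip         = skip
shift (instr i)    = instr (shiftInstr i)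
shift (P ⨾ Q)      = shift P ⨾ shift Q
shift (ifnz r P Q) = ifnz (offset + r) (shift P) (shift Q)
shift (while r P)  = while (offset + r) (shift P)

-- Agreement is pointwise because states are functions and extensionality is not assumed. Addresses
-- are not relocated: both programs see the same memory.
record Sim (s s′ : State) : Set where
  constructor sim
  field
    sim-reg : ∀ r → reg s′ (offset + r) ≡ reg s r
    sim-mem : ∀ a → mem s′ a ≡ mem s a

open Sim

-- For a numeral register the implicit argument is found by computation, so such a fact applies to a
-- register without a proof of the bound.
SameLow : State → State → Set
SameLow s s′ = ∀ r → {True (r <? offset)} → reg s′ r ≡ reg s r

≔-≢ : ∀ (f : ℕ → ℕ) {i v j} → i ≢ j → (f [ i ≔ v ]) j ≡ f j
≔-≢ f {i} {v} {j} i≢j = cong (λ b → if b then v else f j) (dec-false (i ≟ j) i≢j)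

≔-≡ : ∀ (f : ℕ → ℕ) {i v} → (f [ i ≔ v ]) i ≡ v
≔-≡ f {i} {v} = cong (λ b → if b then v else f i) (dec-true (i ≟ i) refl)

≔-cong : ∀ {f g : ℕ → ℕ} {i v v′} → v ≡ v′ → (∀ j → f j ≡ g j) → ∀ j → (f [ i ≔ v ]) j ≡ (g [ i ≔ v′ ]) j
≔-cong {i = i} refl f≗g j with does (i ≟ j)
... | true  = refl
... | false = f≗g j

setReg-sim : ∀ {s s′ v v′ r} → v′ ≡ v → Sim s s′ → Sim (setReg r v s) (setReg (offset + r) v′ s′)
setReg-sim {s} {s′} {v} {r = r} refl (sim ρ μ) = sim lemma μ
  where
  lemma : ∀ r′ → (reg s′ [ offset + r ≔ v ]) (offset + r′) ≡ (reg s [ r ≔ v ]) r′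
  lemma r′ with r ≡ᵇ r′
  ... | true  = refl
  ... | false = ρ r′

setReg-low : ∀ {s v r} → SameLow s (setReg (offset + r) v s)
setReg-low {s} {r = r} r′ {r′<} = ≔-≢ (reg s) {i = offset + r} λ p → <⇒≱ (toWitness r′<) (≤-trans (m≤m+n offset r) (≤-reflexive p))

step-sim : ∀ w i {s s′} → Sim s s′ → Sim (step w i s) (step w (shiftInstr i) s′)
step-sim w (const r v)         σ = setReg-sim refl σ
step-sim w (binop o r r₁ r₂) σ   = setReg-sim (cong₂ (⟦ o ⟧ w) (sim-reg σ r₁) (sim-reg σ r₂)) σ
step-sim w (read r a) {s} {s′} σ = setReg-sim (trans (sim-mem σ _) (cong (mem s) (sim-reg σ a))) σ
step-sim w (write a r) {s} {s′} (sim ρ μ) = sim ρ λ j →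
  trans (cong (λ a → (mem s′ [ a ≔ _ ]) j) (ρ a)) (≔-cong {i = reg s a} (ρ r) μ j)

step-low : ∀ w i {s} → SameLow s (step w (shiftInstr i) s)
step-low w (const r v) {s}       = setReg-low {s} {r = r}
step-low w (binop o r r₁ r₂) {s} = setReg-low {s} {r = r}
step-low w (read r a) {s}        = setReg-low {s} {r = r}
step-low w (write a r)           = λ _ → refl

exec-sim : ∀ {w P s t s₁ s′} → Exec w P s t s₁ → Sim s s′ →
           ∃[ s₁′ ] Exec w (shift P) s′ t s₁′ × Sim s₁ s₁′ × SameLow s′ s₁′
exec-sim skip σ = _ , skip , σ , λ _ → refl
exec-sim {w} (instr {i}) σ = _ , instr , step-sim w i σ , step-low w i
exec-sim (seq e f) σ
  with _ , e′ , σ′ , l  ← exec-sim e σ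
  with _ , f′ , σ″ , l′ ← exec-sim f σ′ = _ , seq e′ f′ , σ″ , λ r {r<} → trans (l′ r {r<}) (l r {r<})
exec-sim (if-yes {r} ≢0 e) σ
  with _ , e′ , σ′ , l ← exec-sim e σ = _ , if-yes (λ p → ≢0 (trans (sym (sim-reg σ r)) p)) e′ , σ′ , l
exec-sim (if-no {r} ≡0 e) σ
  with _ , e′ , σ′ , l ← exec-sim e σ = _ , if-no (trans (sim-reg σ r) ≡0) e′ , σ′ , l
exec-sim (while-0 {r} ≡0) σ = _ , while-0 (trans (sim-reg σ r) ≡0) , σ , λ _ → refl
exec-sim (while-s {r} ≢0 e f) σ
  with _ , e′ , σ′ , l  ← exec-sim e σ
  with _ , f′ , σ″ , l′ ← exec-sim f σ′ =
  _ , while-s (λ p → ≢0 (trans (sym (sim-reg σ r)) p)) e′ f′ , σ″ , λ r {r<} → trans (l′ r {r<}) (l r {r<})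

-- Lists of words laid out in memory

gather : (ℕ → List ℕ) → ℕ → ℕ → List ℕ
gather g i zero    = []
gather g i (suc j) = g i ++ gather g (suc i) j

length-gather : ∀ g {l} → (∀ i → length (g i) ≡ l) → ∀ i j → length (gather g i j) ≡ j * l
length-gather g     len i zero    = refl
length-gather g     len i (suc j) = trans (length-++ (g i)) (cong₂ _+_ (len i) (length-gather g len (suc i) j))

all-gather : ∀ {P : ℕ → Set} {g} i j → (∀ i′ → i ≤ i′ → i′ < i + j → All P (g i′)) → All P (gather g i j)
all-gather i zero    p = All.[]
all-gather i (suc j) p = ++⁺ (p i ≤-refl (m<m+n i z<s))
  (all-gather (suc i) j λ i′ i< i′< → p i′ (<⇒≤ i<) (<-≤-trans i′< (≤-reflexive (sym (+-suc i j)))))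

nth-all : ∀ {b xs} → All (_≤ b) xs → ∀ a → nth xs a ≤ b
nth-all All.[]        a       = z≤n
nth-all (x≤ All.∷ p)  zero    = x≤
nth-all (x≤ All.∷ p)  (suc a) = nth-all p a

writeList : (ℕ → ℕ) → ℕ → List ℕ → ℕ → ℕ
writeList m q []       = m
writeList m q (x ∷ xs) = writeList (m [ q ≔ x ]) (suc q) xs

writeList-< : ∀ {m q} xs {a} → a < q → writeList m q xs a ≡ m a
writeList-< []       a<q = refl
writeList-< {m} (x ∷ xs) a<q = trans (writeList-< xs (m<n⇒m<1+n a<q)) (≔-≢ m (<⇒≢ a<q ∘ sym))

writeList-≥ : ∀ {m q} xs {a} → q + length xs ≤ a → writeList m q xs a ≡ m a
writeList-≥         []       q≤a = refl
writeList-≥ {m} {q} (x ∷ xs) q≤a =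
  trans (writeList-≥ xs (≤-trans (≤-reflexive (sym (+-suc q _))) q≤a))
        (≔-≢ m (<⇒≢ (<-≤-trans (m<m+n q z<s) q≤a)))

writeList-nth : ∀ {m q} xs {a} → a < length xs → writeList m q xs (q + a) ≡ nth xs a
writeList-nth {m} {q} (x ∷ xs) {zero} a<l rewrite +-identityʳ q = trans (writeList-< xs ≤-refl) (≔-≡ m)
writeList-nth {q = q} (x ∷ xs) {suc a} (s≤s a<l) rewrite +-suc q a = writeList-nth xs a<l

nth-≥ : ∀ xs {a} → length xs ≤ a → nth xs a ≡ 0
nth-≥ []       _         = refl
nth-≥ (x ∷ xs) (s≤s l≤a) = nth-≥ xs l≤a

-- The program that writes the encoding of the grammar

-- Registers: 0 answer; 1 n; 2 d; 3 and 4 the constants 1 and 0; 5 σ; 6 address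
-- to write; 7 d + 1; 9 and 11 loop counters; 10 and 12 loop indices, or the
-- ends of the range queried; 13 address to read; 14 scratch, and the outcome of
-- tests; 16 n + 1; 17 a power of 2; 18 length of the input.

-- The constant 1 is the left operand so that the new address reduces to a successor, the form in
-- which `writeList` advances.
emit : Reg → Program → Program
emit r P = instr (write 6 r) ⨾ instr (binop add 6 3 6) ⨾ P

copyStep startStep vectorSymbolStep vectorStep coordinateSymbolStep coordinateStep clearStep : Program
copyLoop startLoop vectorLoop coordinateLoop clearLoop : Program

copyStep =
  instr (read 14 13) ⨾
  instr (write 6 14) ⨾
  instr (binop add 13 3 13) ⨾
  instr (binop add 6 6 3) ⨾
  instr (binop sub 9 9 3) ⨾
  skip

copyLoop =
  -- Adding register 4, which holds 0, serves as a copy between registers.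
  instr (binop add 9 18 4) ⨾
  instr (const 13 0) ⨾
  instr (binop add 6 5 4) ⨾
  while 9 copyStep

startStep =
  emit 4 (
  -- The index is increased before it is written: number 0 is the start symbol, so vector i has
  -- nonterminal i + 1.
  instr (binop add 10 3 10) ⨾
  emit 10 (
  instr (binop sub 9 9 3) ⨾
  skip))

startLoop =
  instr (binop add 9 1 4) ⨾
  instr (const 10 0) ⨾
  while 9 startStep

vectorSymbolStep =
  emit 4 (
  instr (read 14 13) ⨾
  -- The product of the bit and k is the subscript of the string S wanted, k for a 1 and 0 for a 0,
  -- without a branch.
  instr (binop mul 14 14 12) ⨾
  instr (binop add 14 16 14) ⨾
  emit 14 (
  instr (binop add 13 3 13) ⨾
  instr (binop add 12 3 12) ⨾
  instr (binop sub 11 11 3) ⨾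
  skip))

vectorStep =
  emit 7 (
  instr (const 12 0) ⨾
  instr (binop add 11 7 4) ⨾
  while 11 vectorSymbolStep ⨾
  -- A row has d cells but d + 1 were read: the cell for k = 0 is the one before the row. Hence one
  -- step back.
  instr (binop sub 13 13 3) ⨾
  instr (binop sub 9 9 3) ⨾
  skip)

vectorLoop =
  instr (binop add 9 1 4) ⨾
  instr (binop add 13 5 3) ⨾
  while 9 vectorStep

coordinateSymbolStep =
  emit 3 (
  instr (read 14 13) ⨾
  instr (binop mul 14 14 10) ⨾
  instr (binop mul 14 14 1) ⨾
  instr (binop add 14 14 12) ⨾
  -- Letters are encoded from 1 on.
  instr (binop add 14 3 14) ⨾
  emit 14 (
  -- S k needs column k of the matrix, so the reading address advances by the row length.
  instr (binop add 13 13 2) ⨾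
  instr (binop add 12 3 12) ⨾
  instr (binop sub 11 11 3) ⨾
  skip))

coordinateStep =
  emit 1 (
  instr (binop add 13 5 3) ⨾
  instr (binop add 13 13 10) ⨾
  instr (const 12 0) ⨾
  instr (binop add 11 1 4) ⨾
  while 11 coordinateSymbolStep ⨾
  instr (binop add 10 3 10) ⨾
  instr (binop sub 9 9 3) ⨾
  skip)

coordinateLoop =
  instr (binop add 9 7 4) ⨾
  instr (const 10 0) ⨾
  while 9 coordinateStep

clearStep =
  instr (write 6 4) ⨾
  instr (binop add 6 3 6) ⨾
  instr (binop sub 9 9 3) ⨾
  skip

clearLoop =
  instr (binop add 9 18 4) ⨾
  instr (binop add 6 5 4) ⨾
  while 9 clearStep

emitHeader encodeGrammar : Program

emitHeader =
  instr (const 6 0) ⨾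
  emit 5 (
  instr (binop add 14 16 7) ⨾
  emit 14 (
  emit 4 (
  emit 1
  skip)))

encodeGrammar =
  copyLoop ⨾ emitHeader ⨾
  startLoop ⨾ vectorLoop ⨾ coordinateLoop ⨾ clearLoop

-- Correctness of the encoding program

module Encode (w n d σ : ℕ) (D : ℕ → ℕ) where

  -- Coordinate k ≥ 1 of vector i.  X i 0 is the contents of a neighbouring cell
  -- and occurs only multiplied by 0.
  X : ℕ → ℕ → ℕ
  X i k = D (suc (i * d + k))

  startSymbol : ℕ → List ℕ
  startSymbol i = 0 ∷ suc i ∷ []

  vectorSymbol : ℕ → ℕ → List ℕ
  vectorSymbol i k = 0 ∷ suc n + X i k * k ∷ []

  vectorRule : ℕ → List ℕ
  vectorRule i = suc d ∷ gather (vectorSymbol i) 0 (suc d)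

  coordinateSymbol : ℕ → ℕ → List ℕ
  coordinateSymbol k j = 1 ∷ suc (X j k * k * n + j) ∷ []

  coordinateRule : ℕ → List ℕ
  coordinateRule k = n ∷ gather (coordinateSymbol k) 0 n

  -- In `gather` the index rises while the count falls, as the loop registers do. The final `[]`
  -- gives the last loop the shape of the others, a `gather` followed by a rest.
  code : List ℕ
  code = σ ∷ suc n + suc d ∷ 0 ∷ n ∷
         gather startSymbol 0 n ++ gather vectorRule 0 n ++ gather coordinateRule 0 (suc d) ++ []

  -- The registers from 20 on must still be 0 when the data structure is started, as `load`
  -- promises; register 0 keeps the default answer, no.
  Env : State → Set
  Env s = reg s 0 ≡ 0 × reg s 1 ≡ n × reg s 2 ≡ d × reg s 3 ≡ 1 × reg s 4 ≡ 0 × reg s 5 ≡ σ ×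
          reg s 7 ≡ suc d × reg s 16 ≡ suc n × reg s 18 ≡ 2 + n * d × (∀ r → reg s (20 + r) ≡ 0)

  module Correct
    (fits  : σ + (2 + suc n * d) < 2 ^ w)
    (code≤ : length code ≤ σ)
    (rules≤ : suc n + suc d ≤ σ)
    (block≤ : suc (suc d * n) ≤ σ)
    (input≤code : 2 + n * d ≤ length code)
    (X≤ : ∀ i k → i < n → k ≤ d → X i k * k ≤ k)
    where

    total : ℕ
    total = 2 + n * d

    fit : ∀ {x} → x ≤ σ + (2 + suc n * d) → x < 2 ^ w
    fit x≤ = ≤-<-trans x≤ fits

    fitσ : ∀ {x} → x ≤ σ → x < 2 ^ w
    fitσ x≤ = fit (≤-trans x≤ (m≤m+n σ _))

    n≤σ : n ≤ σ
    n≤σ = ≤-trans (n≤1+n n) (≤-trans (m≤m+n (suc n) (suc d)) rules≤)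

    input≤ : total ≤ σ
    input≤ = ≤-trans input≤code code≤

    total≤ : total ≤ 2 + suc n * d
    total≤ = +-monoʳ-≤ 2 (m≤n+m (n * d) d)

    X*k≤ : ∀ {i k} → i < n → k ≤ d → X i k * k ≤ d
    X*k≤ i< k≤ = ≤-trans (X≤ _ _ i< k≤) k≤

    letter< : ∀ {j k} → j < n → k ≤ d → X j k * k * n + j < σ
    letter< {j} {k} j< k≤ = begin-strict
      X j k * k * n + j ≤⟨ +-monoˡ-≤ j (*-monoˡ-≤ n (X*k≤ j< k≤)) ⟩
      d * n + j         ≤⟨ +-monoʳ-≤ (d * n) (<⇒≤ j<) ⟩
      d * n + n         ≡⟨ +-comm (d * n) n ⟩
      suc d * n         <⟨ block≤ ⟩
      σ                 ∎
      where open ≤-Reasoning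

    -- The last clause, zeros behind the copy, is carried along for the final erasure: clearing
    -- `total` cells will then do.
    Copying : ℕ → State → Set
    Copying j s = Env s × reg s 9 ≡ j ×
      (∃[ a ] a + j ≡ total × reg s 13 ≡ a × reg s 6 ≡ σ + a ×
              (∀ b → b < σ → mem s b ≡ D b) × (∀ b → b < a → mem s (σ + b) ≡ D b) ×
              (∀ b → total ≤ b → mem s (σ + b) ≡ 0))

    Copied : State → Set
    Copied s = (∀ b → b < σ → mem s b ≡ D b) × (∀ b → b < total → mem s (σ + b) ≡ D b) ×
               (∀ b → total ≤ b → mem s (σ + b) ≡ 0)

    copyBody : ∀ j s → Copying (suc j) s → Runs w copyStep s 5 (Copying j)
    copyBody j s (env@(_ , n≡ , d≡ , 1≡ , 0≡ , σ≡ , _) , j≡ , a , a+j , a≡ , b≡ , low , copied , high) =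
      do-read a≡ (low a a<σ)
      (do-write b≡ refl
      (do-add 1≡ a≡ (fitσ a<σ)
      (do-add b≡ 1≡ (fit (≤-trans (≤-reflexive (+-assoc σ a 1)) (+-monoʳ-≤ σ (≤-trans (≤-reflexive (+-comm a 1)) (≤-trans a<t total≤)))))
      (do-pred j≡ 1≡ (fitσ (≤-trans j≤ input≤))
      (do-skip (env , refl , suc a , trans (sym (+-suc a j)) a+j , refl , trans (+-comm (σ + a) 1) (sym (+-suc σ a)) , 
         (λ b b<σ → trans (≔-≢ (mem s) λ e → <⇒≱ b<σ (≤-trans (m≤m+n σ a) (≤-reflexive e))) (low b b<σ)) ,
         copied′ ,
         (λ b t≤b → trans (≔-≢ (mem s) λ e → <⇒≢ (<-≤-trans a<t t≤b) (+-cancelˡ-≡ σ a b e)) (high b t≤b))))))))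
      where
      a<t : a < total
      a<t = ≤-trans (m<m+n a z<s) (≤-reflexive a+j)
      a<σ : a < σ
      a<σ = ≤-trans a<t input≤
      j≤ : j ≤ total
      j≤ = ≤-trans (n≤1+n j) (≤-trans (m≤n+m _ a) (≤-reflexive a+j))
      copied′ : ∀ b → b < suc a → (mem s [ σ + a ≔ D a ]) (σ + b) ≡ D b
      copied′ b b≤a with a ≟ b
      ... | yes refl = ≔-≡ (mem s)
      ... | no a≢b   = trans (≔-≢ (mem s) (a≢b ∘ +-cancelˡ-≡ σ a b))
                             (copied b (≤∧≢⇒< (s≤s⁻¹ b≤a) (a≢b ∘ sym)))

    copy : ∀ s → Env s → (∀ b → mem s b ≡ D b) → (∀ b → total ≤ b → D b ≡ 0) →
           Runs w copyLoop s (4 + total * 6) (λ s′ → Env s′ × Copied s′)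
    copy s env@(_ , n≡ , d≡ , 1≡ , 0≡ , σ≡ , d+1≡ , n+1≡ , t≡ , _) input pad =
      do-add t≡ 0≡ (fit (≤-trans (≤-reflexive (+-identityʳ total)) (≤-trans total≤ (m≤n+m _ σ))))
      (do-const (fitσ z≤n)
      (do-add σ≡ 0≡ (fitσ (≤-reflexive (+-identityʳ σ)))
      (runs-mono ≤-refl finish
        (do-while Copying 5 (λ _ _ → proj₁ ∘ proj₂) copyBody total _
          (env , +-identityʳ total , 0 , refl , refl , refl , (λ b _ → input b) , (λ _ ()) ,
           λ b t≤b → trans (input _) (pad _ (≤-trans t≤b (m≤n+m b σ))))))))
      where
      finish : ∀ s′ → Copying 0 s′ → Env s′ × Copied s′
      finish s′ (env , _ , a , a+j , _ , _ , low , copied , high) =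
        env , low , (λ b b<t → copied b (≤-trans b<t (≤-reflexive (trans (sym a+j) (+-identityʳ a))))) , high

    emitted : ℕ → State → State
    emitted y s = setReg 6 (suc (reg s 6)) ⟨ reg s , mem s [ reg s 6 ≔ y ] ⟩

    module Emission (M : ℕ → ℕ) (read-M : ∀ b → b < total → M (σ + b) ≡ D b) where

      -- Stated by means of what remains to be written, this invariant is
      -- maintained by a write definitionally.
      record Remaining (ys : List ℕ) (q : ℕ) (m : ℕ → ℕ) : Set where
        constructor remaining
        field
          position : q + length ys ≡ length code
          written  : writeList m q ys ≡ M

      Emitting : List ℕ → State → Set
      Emitting ys s = Env s × Remaining ys (reg s 6) (mem s)

      -- All writes still to come go below σ, so from σ on the present memory already is the final
      -- one, where the copy of the input is intact.
      read-input : ∀ {ys q m} → Remaining ys q m → ∀ b → b < total → m (σ + b) ≡ D b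
      read-input {ys} {q} {m} (remaining len written) b b<t = begin
        m (σ + b)                ≡⟨ writeList-≥ ys (≤-trans (≤-reflexive len) (≤-trans code≤ (m≤m+n σ b))) ⟨
        writeList m q ys (σ + b) ≡⟨ cong (λ m → m (σ + b)) written ⟩
        M (σ + b)                ≡⟨ read-M b b<t ⟩
        D b                      ∎
        where open ≡-Reasoning

      do-emit : ∀ {r P s T Q y ys} → Emitting (y ∷ ys) s → reg s r ≡ y →
                (Emitting ys (emitted y s) → Runs w P (emitted y s) T Q) →
                Runs w (emit r P) s (2 + T) Q
      do-emit {s = s} {ys = ys} (env@(_ , _ , _ , 1≡ , _) , remaining len written) y≡ run =
        do-write refl y≡ (do-add 1≡ refl
          (fitσ (≤-trans (≤-trans (m≤m+n (suc (reg s 6)) (length ys)) (≤-reflexive len′)) code≤))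
          (run (env , remaining len′ written)))
        where
        len′ : suc (reg s 6) + length ys ≡ length code
        len′ = trans (sym (+-suc (reg s 6) (length ys))) len

      remaining-assoc : ∀ xs {ys zs q m} → Remaining ((xs ++ ys) ++ zs) q m → Remaining (xs ++ ys ++ zs) q m
      remaining-assoc xs {ys} {zs} {q} {m} = subst (λ l → Remaining l q m) (++-assoc xs ys zs)

      i<n : ∀ i {j} → i + suc j ≡ n → i < n
      i<n i {j} eq′ = ≤-trans (m<m+n i z<s) (≤-reflexive eq′)

      k≤d : ∀ k {j} → k + suc j ≡ suc d → k ≤ d
      k≤d k {j} eq′ = s≤s⁻¹ (≤-trans (m<m+n k z<s) (≤-reflexive eq′))

      j≤ : ∀ k {j l} → k + suc j ≡ l → j ≤ l
      j≤ k {j} eq′ = ≤-trans (n≤1+n j) (≤-trans (m≤n+m (suc j) k) (≤-reflexive eq′))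

      next : ∀ k {j l} → k + suc j ≡ l → suc k + j ≡ l
      next k {j} eq′ = trans (sym (+-suc k j)) eq′

      n<σ : suc n ≤ σ
      n<σ = ≤-trans (m≤m+n (suc n) (suc d)) rules≤

      d<σ : suc d ≤ σ
      d<σ = ≤-trans (m≤n+m (suc d) (suc n)) rules≤

      address≤ : ∀ {i k} → i < n → k ≤ d → i * d + k ≤ n * d
      address≤ {i} {k} i< k≤ = begin
        i * d + k ≤⟨ +-monoʳ-≤ (i * d) k≤ ⟩
        i * d + d ≡⟨ +-comm (i * d) d ⟩
        suc i * d ≤⟨ *-monoˡ-≤ d i< ⟩
        n * d     ∎
        where open ≤-Reasoning

      module _ (rest : List ℕ) where

        Start : ℕ → State → Set
        Start j s = ∃[ i ] Emitting (gather startSymbol i j ++ rest) s × reg s 9 ≡ j ×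
                           reg s 10 ≡ i × i + j ≡ n

        startStep-runs : ∀ j s → Start (suc j) s → Runs w startStep s 6 (Start j)
        startStep-runs j s (i , em@((_ , _ , _ , 1≡ , 0≡ , _) , _) , j≡ , i≡ , i+j) =
          do-emit em 0≡ λ em₁ →
          do-add 1≡ i≡ (fitσ (<⇒≤ (≤-<-trans (i<n i i+j) n<σ)))
          (do-emit em₁ refl λ em₂ →
          do-pred j≡ 1≡ (fitσ (≤-trans (j≤ i i+j) n≤σ))
          (do-skip (suc i , em₂ , refl , refl , next i i+j)))

        start-runs : ∀ s → Emitting (gather startSymbol 0 n ++ rest) s →
                     Runs w startLoop s (3 + n * 7) (Emitting rest)
        start-runs s em@((_ , n≡ , _ , _ , 0≡ , _) , _) =
          do-add n≡ 0≡ (fitσ (≤-trans (≤-reflexive (+-identityʳ n)) n≤σ))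
          (do-const (fitσ z≤n)
          (runs-mono ≤-refl (λ s′ (_ , em′ , _) → em′)
            (do-while Start 6 (λ { _ _ (_ , _ , j≡ , _) → j≡ }) startStep-runs n _
              (0 , em , +-identityʳ n , refl , refl))))

        VectorSymbol : ℕ → ℕ → ℕ → State → Set
        VectorSymbol i c j s =
          ∃[ k ] Emitting (gather (vectorSymbol i) k j ++ rest) s × reg s 11 ≡ j × reg s 12 ≡ k ×
                 reg s 13 ≡ σ + suc (i * d + k) × reg s 9 ≡ c × k + j ≡ suc d

        vectorSymbolStep-runs : ∀ i c → i < n → ∀ j s → VectorSymbol i c (suc j) s →
                                Runs w vectorSymbolStep s 10 (VectorSymbol i c j)
        vectorSymbolStep-runs i c i< j s
          (k , em@((_ , _ , _ , 1≡ , 0≡ , _ , _ , n+1≡ , _) , _) , j≡ , k≡ , rp≡ , c≡ , k+j) =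
          do-emit em 0≡ λ em₁ →
          do-read rp≡ (read-input (proj₂ em₁) _ (s≤s (s≤s (address≤ i< k≤))))
          (do-mul refl k≡ (fitσ (≤-trans (<⇒≤ (s≤s (X*k≤ i< k≤))) d<σ))
          (do-add n+1≡ refl (fitσ (≤-trans (+-monoʳ-≤ (suc n) (≤-trans (X*k≤ i< k≤) (n≤1+n d))) rules≤))
          (do-emit em₁ refl λ em₂ →
          do-add 1≡ rp≡ (fit (≤-trans (≤-reflexive (sym (+-suc σ _))) (+-monoʳ-≤ σ (s≤s (s≤s (≤-trans (address≤ i< k≤) (m≤n+m (n * d) d)))))))
          (do-add 1≡ k≡ (fitσ (≤-trans (s≤s k≤) d<σ))
          (do-pred j≡ 1≡ (fitσ (≤-trans (j≤ k k+j) d<σ))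
          (do-skip (suc k , em₂ , refl , refl , advance σ (i * d) k , c≡ , next k k+j)))))))
          where
          k≤ : k ≤ d
          k≤ = k≤d k k+j
          advance : ∀ a b c → 1 + (a + suc (b + c)) ≡ a + suc (b + suc c)
          advance = solve-∀

        VectorSymbol-loop : ∀ i c → i < n → ∀ s → VectorSymbol i c (suc d) s →
                            Runs w (while 11 vectorSymbolStep) s (1 + suc d * 11) (VectorSymbol i c 0)
        VectorSymbol-loop i c i< s =
          do-while (VectorSymbol i c) 10 (λ { _ _ (_ , _ , j≡ , _) → j≡ }) (vectorSymbolStep-runs i c i<) (suc d) s

        CoordinateSymbol : ℕ → ℕ → ℕ → State → Set
        CoordinateSymbol k c j s =
          ∃[ i ] Emitting (gather (coordinateSymbol k) i j ++ rest) s × reg s 11 ≡ j × reg s 12 ≡ i ×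
                 reg s 13 ≡ σ + suc (i * d + k) × reg s 10 ≡ k × reg s 9 ≡ c × i + j ≡ n

        coordinateSymbolStep-runs : ∀ k c → k ≤ d → ∀ j s → CoordinateSymbol k c (suc j) s →
                                    Runs w coordinateSymbolStep s 12 (CoordinateSymbol k c j)
        coordinateSymbolStep-runs k c k≤ j s
          (i , em@((_ , n≡ , d≡ , 1≡ , 0≡ , _) , _) , j≡ , i≡ , rp≡ , k≡ , c≡ , i+j) =
          do-emit em 1≡ λ em₁ →
          do-read rp≡ (read-input (proj₂ em₁) _ (s≤s (s≤s (address≤ i< k≤))))
          (do-mul refl k≡ (fitσ (≤-trans (<⇒≤ (s≤s (X*k≤ i< k≤))) d<σ))
          (do-mul refl n≡ (fitσ (≤-trans (m≤m+n _ i) (<⇒≤ (letter< i< k≤))))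
          (do-add refl i≡ (fitσ (<⇒≤ (letter< i< k≤)))
          (do-add 1≡ refl (fitσ (letter< i< k≤))
          (do-emit em₁ refl λ em₂ →
          do-add rp≡ d≡ (fit (≤-trans (≤-reflexive (+-assoc σ _ d)) (+-monoʳ-≤ σ (s≤s (≤-trans (≤-reflexive (+-comm _ d))
            (≤-trans (+-monoʳ-≤ d (address≤ i< k≤)) (n≤1+n _)))))))
          (do-add 1≡ i≡ (fitσ (≤-trans i< n≤σ))
          (do-pred j≡ 1≡ (fitσ (≤-trans (j≤ i i+j) n≤σ))
          (do-skip (suc i , em₂ , refl , refl , advance σ (i * d) k d , k≡ , c≡ , next i i+j)))))))))
          where
          i< : i < n
          i< = i<n i i+j
          advance : ∀ a b c e → a + suc (b + c) + e ≡ a + suc (e + b + c)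
          advance = solve-∀

        CoordinateSymbol-loop : ∀ k c → k ≤ d → ∀ s → CoordinateSymbol k c n s →
                                Runs w (while 11 coordinateSymbolStep) s (1 + n * 13) (CoordinateSymbol k c 0)
        CoordinateSymbol-loop k c k≤ s =
          do-while (CoordinateSymbol k c) 12 (λ { _ _ (_ , _ , j≡ , _) → j≡ }) (coordinateSymbolStep-runs k c k≤) n s

      module _ (rest : List ℕ) where

        VectorRule : ℕ → State → Set
        VectorRule j s = ∃[ i ] Emitting (gather vectorRule i j ++ rest) s × reg s 9 ≡ j ×
                                reg s 13 ≡ σ + suc (i * d) × i + j ≡ n

        vectorStep-runs : ∀ j s → VectorRule (suc j) s →
                          Runs w vectorStep s (4 + ((1 + suc d * 11) + 2)) (VectorRule j)
        vectorStep-runs j s (i , em@((_ , n≡ , d≡ , 1≡ , 0≡ , _ , d+1≡ , _) , _) , j≡ , rp≡ , i+j) =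
          do-emit em d+1≡ λ em₁ →
          do-const (fitσ z≤n)
          (do-add d+1≡ 0≡ (fitσ (≤-trans (≤-reflexive (+-identityʳ (suc d))) d<σ))
          (do-seq (VectorSymbol-loop _ i (suc j) i< _
                    (0 , (proj₁ em₁ , remaining-assoc (gather (vectorSymbol i) 0 (suc d)) (proj₂ em₁)) , +-identityʳ (suc d) , refl ,
                     trans rp≡ (cong (λ a → σ + suc a) (sym (+-identityʳ (i * d)))) , j≡ , refl))
            λ { s′ (k , em′@((_ , _ , _ , 1≡′ , _) , _) , _ , _ , rp≡′ , j≡′ , k+0) →
          do-pred (trans rp≡′ (rewind k k+0)) 1≡′ (fit (+-monoʳ-≤ σ (s≤s (≤-trans (*-monoˡ-≤ d i<) (≤-trans (m≤n+m _ d) (n≤1+n _))))))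
          (do-pred j≡′ 1≡′ (fitσ (≤-trans (j≤ i i+j) n≤σ))
          (do-skip (suc i , em′ , refl , refl , next i i+j))) }))
          where
          i< : i < n
          i< = i<n i i+j
          arrange : ∀ a b c → a + suc (b + suc c) ≡ suc (a + suc (c + b))
          arrange = solve-∀
          rewind : ∀ k → k + 0 ≡ suc d → σ + suc (i * d + k) ≡ suc (σ + suc (suc i * d))
          rewind k k+0 = trans (cong (λ k → σ + suc (i * d + k)) (trans (sym (+-identityʳ k)) k+0)) (arrange σ (i * d) d)

        vector-runs : ∀ s → Emitting (gather vectorRule 0 n ++ rest) s →
                      Runs w vectorLoop s (3 + n * (5 + ((1 + suc d * 11) + 2))) (Emitting rest)
        vector-runs s em@((_ , n≡ , _ , 1≡ , 0≡ , σ≡ , _) , _) =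
          do-add n≡ 0≡ (fitσ (≤-trans (≤-reflexive (+-identityʳ n)) n≤σ))
          (do-add σ≡ 1≡ (fit (+-monoʳ-≤ σ (s≤s z≤n)))
          (runs-mono ≤-refl (λ s′ (_ , em′ , _) → em′)
            (do-while VectorRule _ (λ { _ _ (_ , _ , j≡ , _) → j≡ }) vectorStep-runs n _
              (0 , em , +-identityʳ n , refl , refl))))

        CoordinateRule : ℕ → State → Set
        CoordinateRule j s = ∃[ k ] Emitting (gather coordinateRule k j ++ rest) s × reg s 9 ≡ j ×
                                    reg s 10 ≡ k × k + j ≡ suc d

        coordinateStep-runs : ∀ j s → CoordinateRule (suc j) s →
                              Runs w coordinateStep s (6 + ((1 + n * 13) + 2)) (CoordinateRule j)
        coordinateStep-runs j s (k , em@((_ , n≡ , d≡ , 1≡ , 0≡ , σ≡ , _) , _) , j≡ , k≡ , k+j) =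
          do-emit em n≡ λ em₁ →
          do-add σ≡ 1≡ (fit (+-monoʳ-≤ σ (s≤s z≤n)))
          (do-add refl k≡ (fit (≤-trans (≤-reflexive (+-assoc σ 1 k)) (+-monoʳ-≤ σ (s≤s (≤-trans k≤ (≤-trans (m≤m+n d (n * d)) (n≤1+n _)))))))
          (do-const (fitσ z≤n)
          (do-add n≡ 0≡ (fitσ (≤-trans (≤-reflexive (+-identityʳ n)) n≤σ))
          (do-seq (CoordinateSymbol-loop _ k (suc j) k≤ _
                    (0 , (proj₁ em₁ , remaining-assoc (gather (coordinateSymbol k) 0 n) (proj₂ em₁)) , +-identityʳ n , refl ,
                     +-assoc σ 1 k , k≡ , j≡ , refl))
            λ { s′ (_ , em′@((_ , _ , _ , 1≡′ , _) , _) , _ , _ , _ , k≡′ , j≡′ , _) →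
          do-add 1≡′ k≡′ (fitσ (≤-trans (s≤s k≤) d<σ))
          (do-pred j≡′ 1≡′ (fitσ (≤-trans (j≤ k k+j) d<σ))
          (do-skip (suc k , em′ , refl , refl , next k k+j))) }))))
          where
          k≤ : k ≤ d
          k≤ = k≤d k k+j

        coordinate-runs : ∀ s → Emitting (gather coordinateRule 0 (suc d) ++ rest) s →
                          Runs w coordinateLoop s (3 + suc d * (7 + ((1 + n * 13) + 2))) (Emitting rest)
        coordinate-runs s em@((_ , n≡ , _ , 1≡ , 0≡ , σ≡ , d+1≡ , _) , _) =
          do-add d+1≡ 0≡ (fitσ (≤-trans (≤-reflexive (+-identityʳ (suc d))) d<σ))
          (do-const (fitσ z≤n)
          (runs-mono ≤-refl (λ s′ (_ , em′ , _) → em′)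
            (do-while CoordinateRule _ (λ { _ _ (_ , _ , j≡ , _) → j≡ }) coordinateStep-runs (suc d) _
              (0 , em , +-identityʳ (suc d) , refl , refl))))

    -- Below σ + a the memory is already final. A cleared cell agrees with `nth code` because `nth`
    -- is 0 beyond the end of the list.
    Clearing : ℕ → State → Set
    Clearing j s = ∃[ a ] Env s × reg s 9 ≡ j × reg s 6 ≡ σ + a × a + j ≡ total ×
                          (∀ b → b < σ + a → mem s b ≡ nth code b) ×
                          (∀ b → total ≤ b → mem s (σ + b) ≡ 0)

    nth-code-≥ : ∀ {b} → σ ≤ b → nth code b ≡ 0
    nth-code-≥ σ≤b = nth-≥ code (≤-trans code≤ σ≤b)

    clearStep-runs : ∀ j s → Clearing (suc j) s → Runs w clearStep s 3 (Clearing j)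
    clearStep-runs j s (a , env@(_ , _ , _ , 1≡ , 0≡ , _) , j≡ , q≡ , a+j , low , high) =
      do-write q≡ 0≡
      (do-add 1≡ q≡ (fit (≤-trans (≤-reflexive (sym (+-suc σ a))) (+-monoʳ-≤ σ (≤-trans a<t total≤))))
      (do-pred j≡ 1≡ (fitσ (≤-trans (≤-trans (n≤1+n j) (≤-trans (m≤n+m _ a) (≤-reflexive a+j))) input≤))
      (do-skip (suc a , env , refl , sym (+-suc σ a) , trans (sym (+-suc a j)) a+j , low′ ,
        λ b t≤b → trans (≔-≢ (mem s) λ e → <⇒≢ (<-≤-trans a<t t≤b) (+-cancelˡ-≡ σ a b e)) (high b t≤b)))))
      where
      a<t : a < total
      a<t = ≤-trans (m<m+n a z<s) (≤-reflexive a+j)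
      low′ : ∀ b → b < σ + suc a → (mem s [ σ + a ≔ 0 ]) b ≡ nth code b
      low′ b b< with σ + a ≟ b
      ... | yes refl = trans (≔-≡ (mem s)) (sym (nth-code-≥ (m≤m+n σ a)))
      ... | no a≢b   = trans (≔-≢ (mem s) a≢b)
        (low b (≤∧≢⇒< (s≤s⁻¹ (≤-trans b< (≤-reflexive (+-suc σ a)))) (a≢b ∘ sym)))

    clear-runs : ∀ s → Env s → (∀ b → b < σ → mem s b ≡ nth code b) → (∀ b → total ≤ b → mem s (σ + b) ≡ 0) →
                 Runs w clearLoop s (3 + total * 4) (λ s′ → Env s′ × (∀ b → mem s′ b ≡ nth code b))
    clear-runs s env@(_ , _ , _ , _ , 0≡ , σ≡ , _ , _ , t≡ , _) low high =
      do-add t≡ 0≡ (fitσ (≤-trans (≤-reflexive (+-identityʳ total)) input≤))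
      (do-add σ≡ 0≡ (fitσ (≤-reflexive (+-identityʳ σ)))
      (runs-mono ≤-refl finish
        (do-while Clearing 3 (λ { _ _ (_ , _ , j≡ , _) → j≡ }) clearStep-runs total _
          (0 , env , +-identityʳ total , refl , refl ,
           (λ b b< → low b (≤-trans b< (≤-reflexive (+-identityʳ σ)))) , high))))
      where
      finish : ∀ s′ → Clearing 0 s′ → Env s′ × (∀ b → mem s′ b ≡ nth code b)
      finish s′ (a , env′ , _ , _ , a+0 , low′ , high′) = env′ , all
        where
        a≡ : a ≡ total
        a≡ = trans (sym (+-identityʳ a)) a+0
        all : ∀ b → mem s′ b ≡ nth code b
        all b with b <? σ + a
        ... | yes b< = low′ b b<
        ... | no b≮  = begin
          mem s′ b             ≡⟨ cong (mem s′) σ+ ⟨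
          mem s′ (σ + (b ∸ σ)) ≡⟨ high′ _ (≤-trans (≤-reflexive (sym a≡)) (≤-trans (≤-reflexive (sym (m+n∸m≡n σ a))) (∸-monoˡ-≤ σ (≮⇒≥ b≮)))) ⟩
          0                    ≡⟨ nth-code-≥ σ≤b ⟨
          nth code b           ∎
          where
          open ≡-Reasoning
          σ≤b : σ ≤ b
          σ≤b = ≤-trans (m≤m+n σ a) (≮⇒≥ b≮)
          σ+ : σ + (b ∸ σ) ≡ b
          σ+ = m+[n∸m]≡n σ≤b

    -- Kept as the sum that the loops produce; `total-overhead` simplifies it with the ring solver.
    encodeTime : ℕ
    encodeTime = (4 + total * 6) + (10 + ((3 + n * 7) + ((3 + n * (5 + ((1 + suc d * 11) + 2))) +
                 ((3 + suc d * (7 + ((1 + n * 13) + 2))) + (3 + total * 4)))))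

    encodeGrammar-runs : ∀ s → Env s → (∀ b → mem s b ≡ D b) → (∀ b → total ≤ b → D b ≡ 0) →
                         Runs w encodeGrammar s encodeTime (λ s′ → Env s′ × (∀ b → mem s′ b ≡ nth code b))
    encodeGrammar-runs s env input pad =
      do-seq (copy s env input pad) λ { s₁ (env₁ , copied) → after-copy s₁ env₁ copied }
      where
      after-copy : ∀ s₁ → Env s₁ → Copied s₁ →
                   Runs w (emitHeader ⨾ startLoop ⨾ vectorLoop ⨾ coordinateLoop ⨾ clearLoop) s₁ _
                        (λ s′ → Env s′ × (∀ b → mem s′ b ≡ nth code b))
      after-copy s₁ env₁@(_ , n≡ , _ , _ , 0≡ , σ≡ , d+1≡ , n+1≡ , _) (low , copied , high) =
        do-seq header λ s₂ em₂ →
        do-seq (start-runs _ s₂ em₂) λ s₃ em₃ →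
        do-seq (vector-runs _ s₃ em₃) λ s₄ em₄ →
        do-seq (coordinate-runs _ s₄ em₄) λ { s₅ (env₅ , remaining _ written) →
        clear-runs s₅ env₅ (λ b b<σ → trans (cong (λ m → m b) written) (M-low b b<σ))
          (λ b t≤b → trans (cong (λ m → m (σ + b)) written) (trans (M-high b) (high b t≤b))) }
        where
        M : ℕ → ℕ
        M = writeList (mem s₁) 0 code
        M-high : ∀ b → M (σ + b) ≡ mem s₁ (σ + b)
        M-high b = writeList-≥ code (≤-trans code≤ (m≤m+n σ b))
        M-low : ∀ b → b < σ → M b ≡ nth code b
        M-low b b<σ with b <? length code
        ... | yes b<l = writeList-nth code b<l
        -- Between the end of the encoding and σ the original memory survives. It is 0 there, the
        -- input being no longer than the encoding.
        ... | no b≮l  = trans (writeList-≥ code l≤b) (trans (low b b<σ) (trans (pad b (≤-trans input≤code l≤b)) (sym (nth-≥ code l≤b))))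
          where
          l≤b : length code ≤ b
          l≤b = ≮⇒≥ b≮l
        open Emission M (λ b b<t → trans (M-high b) (copied b b<t))
        header : Runs w emitHeader s₁ 10 (Emitting (gather startSymbol 0 n ++ gather vectorRule 0 n ++ gather coordinateRule 0 (suc d) ++ []))
        header =
          do-const (fitσ z≤n)
          (do-emit (env₁ , remaining refl refl) σ≡ λ em →
          do-add n+1≡ d+1≡ (fitσ rules≤)
          (do-emit em refl λ em →
          do-emit em 0≡ λ em →
          do-emit em n≡ λ em →
          do-skip em))

    -- Serves to show that `load`, which truncates every entry to a word, leaves the encoding
    -- unchanged.
    code-fits : All (_≤ σ) code
    code-fits =
      ≤-refl All.∷ rules≤ All.∷ z≤n All.∷ n≤σ All.∷
      ++⁺ (all-gather 0 n λ i _ i< → z≤n All.∷ ≤-trans i< n≤σ All.∷ All.[])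
      (++⁺ (all-gather 0 n λ i _ i< → ≤-trans (m≤n+m (suc d) (suc n)) rules≤ All.∷
              all-gather 0 (suc d) λ k _ k< → z≤n All.∷ vector≤ i k i< (s≤s⁻¹ k<) All.∷ All.[])
      (++⁺ (all-gather 0 (suc d) λ k _ k< → n≤σ All.∷
              all-gather 0 n λ j _ j< → 1≤σ All.∷ letter< j< (s≤s⁻¹ k<) All.∷ All.[])
      All.[]))
      where
      1≤σ : 1 ≤ σ
      1≤σ = ≤-trans (s≤s z≤n) rules≤
      vector≤ : ∀ i k → i < n → k ≤ d → suc n + X i k * k ≤ σ
      vector≤ i k i< k≤ = ≤-trans (+-monoʳ-≤ (suc n) (≤-trans (X*k≤ i< k≤) (n≤1+n d))) rules≤

-- Concatenated blocks and numbers of occurrences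

module _ {X : Set} where

  blocks : ∀ {n} → (Fin n → List X) → List X
  blocks f = concat (tabulate f)

  blocks-split : ∀ m {n} (f : Fin (m + n) → List X) →
                 blocks f ≡ blocks (f ∘ (_↑ˡ n)) ++ blocks (f ∘ (m ↑ʳ_))
  blocks-split zero    f = refl
  blocks-split (suc m) f = trans (cong (f zero ++_) (blocks-split m (f ∘ suc))) (sym (++-assoc (f zero) _ _))

  length-blocks : ∀ {n l} (f : Fin n → List X) → (∀ i → length (f i) ≡ l) → length (blocks f) ≡ n * l
  length-blocks {zero}  f len = refl
  length-blocks {suc n} f len = trans (length-++ (f zero)) (cong₂ _+_ (len zero) (length-blocks (f ∘ suc) (len ∘ suc)))

  blocks-focus : ∀ {n l} (f : Fin n → List X) → (∀ i → length (f i) ≡ l) → ∀ i →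
                 ∃[ pre ] ∃[ post ] blocks f ≡ pre ++ f i ++ post × length pre ≡ toℕ i * l
  blocks-focus f len zero    = [] , _ , refl , refl
  blocks-focus f len (suc i) with pre , post , e , l ← blocks-focus (f ∘ suc) (len ∘ suc) i =
    f zero ++ pre , post , trans (cong (f zero ++_) e) (sym (++-assoc (f zero) pre _)) ,
    trans (length-++ (f zero)) (cong₂ _+_ (len zero) l)

concatMap-tabulate : ∀ {X Y : Set} {n} (f : X → List Y) (h : Fin n → X) →
                     concatMap f (tabulate h) ≡ blocks (f ∘ h)
concatMap-tabulate f h = cong concat (map-tabulate h f)

blocks-gather : ∀ {n} {f : Fin n → List ℕ} (g : ℕ → List ℕ) b → (∀ i → f i ≡ g (b + toℕ i)) →
                blocks f ≡ gather g b n
blocks-gather {zero}  g b e = refl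
blocks-gather {suc n} g b e =
  cong₂ _++_ (trans (e zero) (cong g (+-identityʳ b)))
             (blocks-gather g (suc b) λ i → trans (e (suc i)) (cong g (+-suc b (toℕ i))))

module _ {X Y : Set} (f : X → Y) where

  map-blocks : ∀ {n} (g : Fin n → List X) → map f (blocks g) ≡ blocks (map f ∘ g)
  map-blocks {zero}  g = refl
  map-blocks {suc n} g = trans (map-++ f (g zero) _) (cong (map f (g zero) ++_) (map-blocks (g ∘ suc)))

bit≤1 : (b : Fin 2) → toℕ b ≤ 1
bit≤1 b = s≤s⁻¹ (toℕ<n b)

dot≡0⇒ : ∀ {d} (x y : Vec (Fin 2) d) → ⟨ x ∙ y ⟩ ≡ 0 → ∀ k → toℕ (lookup x k) * toℕ (lookup y k) ≡ 0
dot≡0⇒ (a ∷ x) (b ∷ y) e zero    = m+n≡0⇒m≡0 _ e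
dot≡0⇒ (a ∷ x) (b ∷ y) e (suc k) = dot≡0⇒ x y (m+n≡0⇒n≡0 (toℕ a * toℕ b) e) k

dot≡0⇐ : ∀ {d} (x y : Vec (Fin 2) d) → (∀ k → toℕ (lookup x k) * toℕ (lookup y k) ≡ 0) → ⟨ x ∙ y ⟩ ≡ 0
dot≡0⇐ []      []      e = refl
dot≡0⇐ (a ∷ x) (b ∷ y) e = cong₂ _+_ (e zero) (dot≡0⇐ x y (e ∘ suc))

# : ∀ {n} → (Fin n → Bool) → ℕ
# {zero}  p = 0
# {suc n} p = (if p zero then 1 else 0) + # (p ∘ suc)

#-cong : ∀ {n} {p q : Fin n → Bool} → (∀ i → p i ≡ q i) → # p ≡ # q
#-cong {zero}  e = refl
#-cong {suc n} e = cong₂ (λ b m → (if b then 1 else 0) + m) (e zero) (#-cong (e ∘ suc))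

#-false : ∀ {n} {p : Fin n → Bool} → (∀ i → p i ≡ false) → # p ≡ 0
#-false {zero}  e = refl
#-false {suc n} e rewrite e zero = #-false (e ∘ suc)

length-filter-tabulate : ∀ {X : Set} {P : X → Set} (P? : Decidable P) {n} (f : Fin n → X) →
                         length (filter P? (tabulate f)) ≡ # (does ∘ P? ∘ f)
length-filter-tabulate P? {zero}  f = refl
length-filter-tabulate P? {suc n} f with does (P? (f zero))
... | true  = cong suc (length-filter-tabulate P? (f ∘ suc))
... | false = length-filter-tabulate P? (f ∘ suc)

module _ {σ : ℕ} where

  count : Fin σ → List (Fin σ) → ℕ
  count c []       = 0
  count c (x ∷ xs) = (if does (x Fin.≟ c) then 1 else 0) + count c xs

  count-++ : ∀ c xs ys → count c (xs ++ ys) ≡ count c xs + count c ys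
  count-++ c []       ys = refl
  count-++ c (x ∷ xs) ys = trans (cong (_ +_) (count-++ c xs ys)) (sym (+-assoc _ (count c xs) (count c ys)))

  count-tabulate-1≤ : ∀ {n} (f : Fin n → Fin σ) c i → f i ≡ c → 1 ≤ count c (tabulate f)
  count-tabulate-1≤ f c zero    e rewrite dec-true (f zero Fin.≟ c) e = s≤s z≤n
  count-tabulate-1≤ f c (suc i) e = ≤-trans (count-tabulate-1≤ (f ∘ suc) c i e) (m≤n+m _ _)

  count-tabulate-≤1 : ∀ {n} (f : Fin n → Fin σ) c → (∀ i j → f i ≡ f j → i ≡ j) → count c (tabulate f) ≤ 1
  count-tabulate-∈ : ∀ {n} (f : Fin n → Fin σ) c → 1 ≤ count c (tabulate f) → ∃[ i ] f i ≡ c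

  count-tabulate-∈ {suc n} f c 1≤ with f zero Fin.≟ c
  ... | yes e = zero , e
  ... | no _ with i , e ← count-tabulate-∈ (f ∘ suc) c 1≤ = suc i , e

  count-tabulate-≤1 {zero}  f c inj = z≤n
  count-tabulate-≤1 {suc n} f c inj with f zero Fin.≟ c
  ... | no _  = count-tabulate-≤1 (f ∘ suc) c (λ i j e → case inj (suc i) (suc j) e of λ { refl → refl })
  ... | yes e with count c (tabulate (f ∘ suc)) in eq′
  ...   | zero  = ≤-refl
  ...   | suc m with i , e′ ← count-tabulate-∈ (f ∘ suc) c (≤-trans (s≤s z≤n) (≤-reflexive (sym eq′)))
               with () ← inj zero (suc i) (trans e (sym e′))

  count-blocks-≥ : ∀ {n} (f : Fin n → List (Fin σ)) c → (∀ i → 1 ≤ count c (f i)) → n ≤ count c (blocks f)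
  count-blocks-≥ {zero}  f c 1≤ = z≤n
  count-blocks-≥ {suc n} f c 1≤ = ≤-trans (+-mono-≤ (1≤ zero) (count-blocks-≥ (f ∘ suc) c (1≤ ∘ suc)))
                                          (≤-reflexive (sym (count-++ c (f zero) _)))

  count-blocks-≤ : ∀ {n} (f : Fin n → List (Fin σ)) c → (∀ i → count c (f i) ≤ 1) → count c (blocks f) ≤ n
  count-blocks-≤ {zero}  f c ≤1 = z≤n
  count-blocks-≤ {suc n} f c ≤1 = ≤-trans (≤-reflexive (count-++ c (f zero) _))
                                          (+-mono-≤ (≤1 zero) (count-blocks-≤ (f ∘ suc) c (≤1 ∘ suc)))

  -- Pigeonhole: n blocks contribute at most 1 each, so a total of n leaves none without a
  -- contribution.
  count-blocks-full : ∀ {n} (f : Fin n → List (Fin σ)) c → (∀ i → count c (f i) ≤ 1) →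
                      n ≤ count c (blocks f) → ∀ i → 1 ≤ count c (f i)
  count-blocks-full {suc n} f c ≤1 n≤ i = go i
    where
    n≤′ : suc n ≤ count c (f zero) + count c (blocks (f ∘ suc))
    n≤′ = ≤-trans n≤ (≤-reflexive (count-++ c (f zero) _))
    go : ∀ i → 1 ≤ count c (f i)
    go zero    = +-cancelʳ-≤ n 1 _ (≤-trans n≤′ (+-monoʳ-≤ _ (count-blocks-≤ (f ∘ suc) c (≤1 ∘ suc))))
    go (suc i) = count-blocks-full (f ∘ suc) c (≤1 ∘ suc) (+-cancelˡ-≤ 1 n _ (≤-trans n≤′ (+-monoˡ-≤ _ (≤1 zero)))) i

  -- On booleans `<ᵇ` cancels successors by computation. Once `occ` is rewritten as a count of this
  -- test, dropping the first letter of a string and shifting the range by one therefore holds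
  -- definitionally.
  inRange : ∀ {N} → Vec (Fin σ) N → ℕ → ℕ → Fin σ → Fin N → Bool
  inRange T b e c i = (b <ᵇ suc (toℕ i)) ∧ (toℕ i <ᵇ e) ∧ does (lookup T i Fin.≟ c)

  occ-# : ∀ {N} (T : Vec (Fin σ) N) b e c → occ T b e c ≡ # (inRange T b e c)
  occ-# T b e c = length-filter-tabulate
    (λ i → b <? suc (toℕ i) ×-dec suc (toℕ i) ≤? e ×-dec lookup T i Fin.≟ c) id

  occ-drop : ∀ xs {ys} b e c →
             occ (Vec.fromList (xs ++ ys)) (length xs + b) (length xs + e) c ≡ occ (Vec.fromList ys) b e c
  occ-drop []            b e c = refl
  occ-drop (x ∷ xs) {ys} b e c = trans (occ-# (Vec.fromList (x ∷ xs ++ ys)) (suc (length xs + b)) (suc (length xs + e)) c)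
    (trans (sym (occ-# (Vec.fromList (xs ++ ys)) (length xs + b) (length xs + e) c)) (occ-drop xs b e c))

  occ-take : ∀ xs {ys} c → occ (Vec.fromList (xs ++ ys)) 0 (length xs) c ≡ count c xs
  occ-take [] {ys} c = trans (occ-# (Vec.fromList ys) 0 0 c) (#-false {p = inRange (Vec.fromList ys) 0 0 c} λ _ → refl)
  occ-take (x ∷ xs) {ys} c = trans (occ-# (Vec.fromList (x ∷ xs ++ ys)) 0 (suc (length xs)) c)
    (cong ((if does (x Fin.≟ c) then 1 else 0) +_)
          (trans (sym (occ-# (Vec.fromList (xs ++ ys)) 0 (length xs) c)) (occ-take xs c)))

  occ-segment : ∀ {ws} pre xs {post} c → ws ≡ pre ++ xs ++ post →
                occ (Vec.fromList ws) (length pre) (length pre + length xs) c ≡ count c xs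
  occ-segment pre xs {post} c refl = begin
    occ T (length pre) (length pre + length xs) c       ≡⟨ cong (λ b → occ T b (length pre + length xs) c) (+-identityʳ (length pre)) ⟨
    occ T (length pre + 0) (length pre + length xs) c   ≡⟨ occ-drop pre 0 (length xs) c ⟩
    occ (Vec.fromList (xs ++ post)) 0 (length xs) c     ≡⟨ occ-take xs c ⟩
    count c xs                                          ∎
    where
    open ≡-Reasoning
    T = Vec.fromList (pre ++ xs ++ post)

  occ≤modeFreq : ∀ {N} (T : Vec (Fin σ) N) b e c → occ T b e c ≤ modeFreq T b e
  occ≤modeFreq T b e c = v≤max⁺ 0 (map (occ T b e) (allFin σ))
    (inj₂ (lose (∈-map⁺ (occ T b e) (∈-allFin c)) ≤-refl))

  -- Positivity excludes the default 0 from which `max` starts and which no letter need attain.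
  modeFreq-attained : ∀ {N} (T : Vec (Fin σ) N) b e → 0 < modeFreq T b e → ∃[ c ] occ T b e c ≡ modeFreq T b e
  modeFreq-attained T b e 0< with argmax-sel id 0 (map (occ T b e) (allFin σ))
  ... | inj₁ ≡0 = contradiction ≡0 (<⇒≢ 0< ∘ sym)
  ... | inj₂ ∈map with c , _ , e′ ← ∈-map⁻ (occ T b e) ∈map = c , sym e′

-- Derivations in straight-line grammars

module Derivation {σ : ℕ} (G : SLG σ) where
  open SLG G

  _⇒*_ : List Symbol → List Symbol → Set
  _⇒*_ = Star _⇒_

  ⇒*-context : ∀ γ δ {α β} → α ⇒* β → (γ ++ α ++ δ) ⇒* (γ ++ β ++ δ)
  ⇒*-context γ δ nil = nil
  ⇒*-context γ δ (rewriteNT α A β ◅ r) =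
    subst₂ _⇒_ (regroup (inj₁ A ∷ β))
               (trans (cong ((γ ++ α) ++_) (sym (++-assoc (rhs A) β δ))) (regroup (rhs A ++ β)))
           (rewriteNT (γ ++ α) A (β ++ δ)) ◅ ⇒*-context γ δ r
    where
    regroup : ∀ ρ → (γ ++ α) ++ ρ ++ δ ≡ γ ++ (α ++ ρ) ++ δ
    regroup ρ = trans (++-assoc γ α (ρ ++ δ)) (cong (γ ++_) (sym (++-assoc α ρ δ)))

  ⇒*-rule : ∀ A → [ inj₁ A ] ⇒* rhs A
  ⇒*-rule A = subst ([ inj₁ A ] ⇒_) (++-identityʳ (rhs A)) (rewriteNT [] A []) ◅ nil

  ⇒*-++ : ∀ {α α′ β β′} → α ⇒* α′ → β ⇒* β′ → (α ++ β) ⇒* (α′ ++ β′)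
  ⇒*-++ {α} {α′} {β} {β′} r r′ = ⇒*-context [] β r ◅◅
    subst₂ _⇒*_ (cong (α′ ++_) (++-identityʳ β)) (cong (α′ ++_) (++-identityʳ β′)) (⇒*-context α′ [] r′)

  ⇒*-tabulate : ∀ {n} {h : Fin n → Symbol} {g : Fin n → List Symbol} → (∀ i → [ h i ] ⇒* g i) → tabulate h ⇒* blocks g
  ⇒*-tabulate {zero}  r = nil
  ⇒*-tabulate {suc n} r = ⇒*-++ (r zero) (⇒*-tabulate (r ∘ suc))

-- The layout of the vectors in the input

nth-++-< : ∀ xs {ys i} → i < length xs → nth (xs ++ ys) i ≡ nth xs i
nth-++-< (x ∷ xs) {i = zero}  i<     = refl
nth-++-< (x ∷ xs) {i = suc i} (s≤s i<) = nth-++-< xs i<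

nth-++-≥ : ∀ xs {ys} i → nth (xs ++ ys) (length xs + i) ≡ nth ys i
nth-++-≥ []       i = refl
nth-++-≥ (x ∷ xs) i = nth-++-≥ xs i

bits : ∀ {d} → Vec (Fin 2) d → List ℕ
bits x = map toℕ (Vec.toList x)

length-bits : ∀ {d} (x : Vec (Fin 2) d) → length (bits x) ≡ d
length-bits []      = refl
length-bits (a ∷ x) = cong suc (length-bits x)

nth-bits : ∀ {d} (x : Vec (Fin 2) d) k → nth (bits x) (toℕ k) ≡ toℕ (lookup x k)
nth-bits (a ∷ x) zero    = refl
nth-bits (a ∷ x) (suc k) = nth-bits x k

nth-matrix : ∀ {n d} (A : Vec (Vec (Fin 2) d) n) i k →
             nth (concatMap bits (Vec.toList A)) (toℕ i * d + toℕ k) ≡ toℕ (lookup (lookup A i) k)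
nth-matrix {d = d} (x ∷ A) zero k =
  trans (nth-++-< (bits x) (≤-trans (toℕ<n k) (≤-reflexive (sym (length-bits x))))) (nth-bits x k)
nth-matrix {d = d} (x ∷ A) (suc i) k = begin
  nth (bits x ++ R) (d + toℕ i * d + toℕ k)                 ≡⟨ cong (nth (bits x ++ R)) (+-assoc d (toℕ i * d) (toℕ k)) ⟩
  nth (bits x ++ R) (d + (toℕ i * d + toℕ k))               ≡⟨ cong (λ l → nth (bits x ++ R) (l + (toℕ i * d + toℕ k))) (length-bits x) ⟨
  nth (bits x ++ R) (length (bits x) + (toℕ i * d + toℕ k)) ≡⟨ nth-++-≥ (bits x) (toℕ i * d + toℕ k) ⟩
  nth R (toℕ i * d + toℕ k)                                 ≡⟨ nth-matrix A i k ⟩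
  toℕ (lookup (lookup A i) k)                               ∎
  where
  open ≡-Reasoning
  R = concatMap bits (Vec.toList A)

length-matrix : ∀ {n d} (A : Vec (Vec (Fin 2) d) n) → length (concatMap bits (Vec.toList A)) ≡ n * d
length-matrix []      = refl
length-matrix (x ∷ A) = trans (length-++ (bits x)) (cong₂ _+_ (length-bits x) (length-matrix A))

sum-tabulate : ∀ {n c} (f : Fin n → ℕ) → (∀ i → f i ≡ c) → sum (tabulate f) ≡ n * c
sum-tabulate {zero}  f e = refl
sum-tabulate {suc n} f e = cong₂ _+_ (e zero) (sum-tabulate (f ∘ suc) (e ∘ suc))

sum-split : ∀ m {n} (f : Fin (m + n) → ℕ) →
            sum (tabulate f) ≡ sum (tabulate (f ∘ (_↑ˡ n))) + sum (tabulate (f ∘ (m ↑ʳ_)))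
sum-split zero    f = refl
sum-split (suc m) f = trans (cong (f zero +_) (sum-split m (f ∘ suc))) (sym (+-assoc (f zero) _ _))

-- The grammar and the mode frequencies of its blocks

mask : ∀ {d} → Fin 2 → Fin (suc d) → Fin (suc d)
mask zero       k = zero
mask (suc zero) k = k

toℕ-mask : ∀ {d} b (k : Fin (suc d)) → toℕ (mask b k) ≡ toℕ b * toℕ k
toℕ-mask zero       k = refl
toℕ-mask (suc zero) k = sym (+-identityʳ (toℕ k))

module Grammar {n d σ : ℕ} (A : Vec (Vec (Fin 2) d) n) (block≤ : suc d * n ≤ σ) where

  -- Coordinate 0, which vanishes for all vectors, is added to the given ones.
  bit : Fin n → Fin (suc d) → Fin 2
  bit i k = lookup (zero ∷ lookup A i) k

  -- Letters come in d + 1 groups of n, and the letter of vector j in S k is the j-th of the group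
  -- given here. Group 0 holds the common letters; group k ≥ 1 holds those reserved for coordinate
  -- k.
  shared : Fin (suc d) → Fin n → ℕ
  shared k j = toℕ (bit j k) * toℕ k

  shared≤ : ∀ k j → shared k j ≤ d
  shared≤ k j = ≤-trans (*-monoˡ-≤ (toℕ k) (bit≤1 (bit j k))) (≤-trans (≤-reflexive (+-identityʳ (toℕ k))) (s≤s⁻¹ (toℕ<n k)))

  letter< : ∀ k j → shared k j * n + toℕ j < σ
  letter< k j = begin-strict
    shared k j * n + toℕ j ≤⟨ +-monoˡ-≤ (toℕ j) (*-monoˡ-≤ n (shared≤ k j)) ⟩
    d * n + toℕ j          <⟨ +-monoʳ-< (d * n) (toℕ<n j) ⟩
    d * n + n              ≡⟨ +-comm (d * n) n ⟩
    suc d * n              ≤⟨ block≤ ⟩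
    σ                      ∎
    where open ≤-Reasoning

  letter : Fin (suc d) → Fin n → Fin σ
  letter k j = fromℕ< (letter< k j)

  toℕ-letter : ∀ k j → toℕ (letter k j) ≡ shared k j * n + toℕ j
  toℕ-letter k j = toℕ-fromℕ< (letter< k j)

  NT : Set
  NT = Fin (suc (n + suc d))

  vectorNT : Fin n → NT
  vectorNT i = suc (i ↑ˡ suc d)

  coordinateNT : Fin (suc d) → NT
  coordinateNT k = suc (n ↑ʳ k)

  select : Fin n → Fin (suc d) → Fin (suc d)
  select i k = mask (bit i k) k

  rule : Fin n ⊎ Fin (suc d) → List (NT ⊎ Fin σ)
  rule (inj₁ i) = tabulate (inj₁ ∘ coordinateNT ∘ select i)
  rule (inj₂ k) = tabulate (inj₂ ∘ letter k)

  rules : NT → List (NT ⊎ Fin σ)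
  rules zero    = tabulate (inj₁ ∘ vectorNT)
  rules (suc a) = rule (splitAt n a)

  rules-vector : ∀ i → rules (vectorNT i) ≡ rule (inj₁ i)
  rules-vector i = cong rule (splitAt-↑ˡ n i (suc d))

  rules-coordinate : ∀ k → rules (coordinateNT k) ≡ rule (inj₂ k)
  rules-coordinate k = cong rule (splitAt-↑ʳ n (suc d) k)

  -- Start symbol, vectors and coordinates are numbered in this order, and each kind refers to the
  -- next one only, so the identity permutation orders the grammar.
  rules-ordered : ∀ a b → inj₁ b ∈ rules a → a Fin.< b
  rules-ordered zero b b∈ with _ , refl ← ∈-tabulate⁻ {f = inj₁ ∘ vectorNT} b∈ = s≤s z≤n
  rules-ordered (suc a) b b∈ with splitAt n a in e
  ... | inj₂ k with _ , () ← ∈-tabulate⁻ {f = inj₂ ∘ letter k} b∈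
  ... | inj₁ i with k , refl ← ∈-tabulate⁻ {f = inj₁ ∘ coordinateNT ∘ select i} b∈ | refl ← splitAt⁻¹-↑ˡ e = s≤s (begin-strict
      toℕ (i ↑ˡ suc d)        ≡⟨ toℕ-↑ˡ i (suc d) ⟩
      toℕ i                   <⟨ toℕ<n i ⟩
      n                       ≤⟨ m≤m+n n _ ⟩
      n + toℕ (select i k)    ≡⟨ toℕ-↑ʳ n (select i k) ⟨
      toℕ (n ↑ʳ select i k)   ∎)
      where open ≤-Reasoning

  grammar : SLG σ
  grammar = record
    { numNT   = suc (n + suc d)
    ; rhs     = rules
    ; start   = zero
    ; order   = Permutation.id
    ; ordered = rules-ordered
    }

  open SLG grammar using (size; encode; encodeSymbol; Represents)
  open Derivation grammar

  block : Fin n → List (Fin σ)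
  block i = blocks (λ k → tabulate (letter (select i k)))

  text : List (Fin σ)
  text = blocks block

  length-block : ∀ i → length (block i) ≡ suc d * n
  length-block i = length-blocks {l = n} (λ k → tabulate (letter (select i k))) (λ k → length-tabulate _)

  length-text : length text ≡ n * (suc d * n)
  length-text = length-blocks {l = suc d * n} block length-block

  represents : Represents (Vec.fromList text)
  represents = subst ([ inj₁ zero ] ⇒*_) (trans (sym (map-blocks inj₂ block)) (cong (map inj₂) (sym (toList∘fromList text))))
    (⇒*-rule zero ◅◅ ⇒*-tabulate λ i →
     subst ([ inj₁ (vectorNT i) ] ⇒*_) (rules-vector i) (⇒*-rule (vectorNT i)) ◅◅
     subst (rule (inj₁ i) ⇒*_) (sym (map-blocks inj₂ λ k → tabulate (letter (select i k))))
       (⇒*-tabulate λ k → subst ([ inj₁ (coordinateNT (select i k)) ] ⇒*_)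
         (trans (rules-coordinate (select i k)) (sym (map-tabulate (letter (select i k)) inj₂)))
         (⇒*-rule (coordinateNT (select i k)))))

  size≡ : size ≡ (n ⊔ 1) + (n * (suc d ⊔ 1) + suc d * (n ⊔ 1))
  size≡ = trans (cong sum (map-tabulate id (λ a → length (rules a) ⊔ 1)))
    (cong₂ _+_ (cong (_⊔ 1) (length-tabulate (inj₁ ∘ vectorNT)))
      (trans (sum-split n (λ a → length (rules (suc a)) ⊔ 1))
        (cong₂ _+_
          (sum-tabulate _ λ i → cong (_⊔ 1) (trans (cong length (rules-vector i)) (length-tabulate (inj₁ ∘ coordinateNT ∘ select i))))
          (sum-tabulate _ λ k → cong (_⊔ 1) (trans (cong length (rules-coordinate k)) (length-tabulate (inj₂ ∘ letter k)))))))

  module _ (w : ℕ) where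
    open Encode w n d σ (nth (encodeOV A))

    shared≡X : ∀ k j → shared k j ≡ X (toℕ j) (toℕ k) * toℕ k
    shared≡X zero    j = sym (*-zeroʳ (X (toℕ j) 0))
    shared≡X (suc k) j = cong (_* suc (toℕ k)) (sym (trans
      (cong (nth (d ∷ concatMap bits (Vec.toList A))) (+-suc (toℕ j * d) (toℕ k))) (nth-matrix A j k)))

    encodeRule : NT → List ℕ
    encodeRule a = length (rules a) ∷ concatMap encodeSymbol (rules a)

    -- Joins the two descriptions of the grammar: the program writes `code`, computed from input
    -- cells, while the data structure is promised to work on `encode`.
    encode≡code : encode ≡ code
    encode≡code = cong (λ l → σ ∷ suc n + suc d ∷ 0 ∷ l) (trans (concatMap-tabulate encodeRule id)
      (cong₂ _++_ start≡ (trans (blocks-split n (encodeRule ∘ suc))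
        (cong₂ _++_ (blocks-gather vectorRule 0 vector≡)
                    (trans (blocks-gather coordinateRule 0 coordinate≡) (sym (++-identityʳ _)))))))
      where
      start≡ : encodeRule zero ≡ n ∷ gather startSymbol 0 n
      start≡ = cong₂ _∷_ (length-tabulate _) (trans (concatMap-tabulate encodeSymbol (inj₁ ∘ vectorNT))
        (blocks-gather {n} startSymbol 0 λ i → cong (λ a → 0 ∷ suc a ∷ []) (toℕ-↑ˡ i (suc d))))
      vector≡ : ∀ i → encodeRule (vectorNT i) ≡ vectorRule (toℕ i)
      vector≡ i = trans (cong (λ r → length r ∷ concatMap encodeSymbol r) (rules-vector i))
        (cong₂ _∷_ (length-tabulate (inj₁ ∘ coordinateNT ∘ select i))
          (trans (concatMap-tabulate encodeSymbol (inj₁ ∘ coordinateNT ∘ select i))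
            (blocks-gather (vectorSymbol (toℕ i)) 0 λ k → cong (λ a → 0 ∷ suc a ∷ [])
              (trans (toℕ-↑ʳ n (select i k)) (cong (n +_) (trans (toℕ-mask (bit i k) k) (shared≡X k i)))))))
      coordinate≡ : ∀ k → encodeRule (coordinateNT k) ≡ coordinateRule (toℕ k)
      coordinate≡ k = trans (cong (λ r → length r ∷ concatMap encodeSymbol r) (rules-coordinate k))
        (cong₂ _∷_ (length-tabulate (inj₂ ∘ letter k))
          (trans (concatMap-tabulate encodeSymbol (inj₂ ∘ letter k))
            (blocks-gather (coordinateSymbol (toℕ k)) 0 λ j → cong (λ a → 1 ∷ suc a ∷ [])
              (trans (toℕ-letter k j) (cong (λ s → s * n + toℕ j) (shared≡X k j))))))

  Orthogonal : Fin n → Set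
  Orthogonal i = ∃[ j ] ⟨ lookup A i ∙ lookup A j ⟩ ≡ 0

  blockMode : Fin n → ℕ
  blockMode i = modeFreq (Vec.fromList text) (toℕ i * (suc d * n)) (toℕ i * (suc d * n) + suc d * n)

  occ-block : ∀ i c → occ (Vec.fromList text) (toℕ i * (suc d * n)) (toℕ i * (suc d * n) + suc d * n) c ≡ count c (block i)
  occ-block i c with pre , post , e , l ← blocks-focus {l = suc d * n} block length-block i =
    trans (cong₂ (λ a b → occ (Vec.fromList text) a (a + b) c) (sym l) (sym (length-block i))) (occ-segment pre (block i) c e)

  -- Uniqueness of quotient and remainder on division by n.
  letter-unique : ∀ {s j s′ j′} → s * n + toℕ {n} j ≡ s′ * n + toℕ {n} j′ → s ≡ s′ × j ≡ j′
  letter-unique {zero}  {j} {zero}   {j′} e = refl , toℕ-injective e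
  letter-unique {zero}  {j} {suc s′} {j′} e =
    contradiction e (<⇒≢ (≤-trans (toℕ<n j) (≤-trans (m≤m+n n (s′ * n)) (m≤m+n (suc s′ * n) (toℕ j′)))))
  letter-unique {suc s} {j} {zero}   {j′} e =
    contradiction (sym e) (<⇒≢ (≤-trans (toℕ<n j′) (≤-trans (m≤m+n n (s * n)) (m≤m+n (suc s * n) (toℕ j)))))
  letter-unique {suc s} {j} {suc s′} {j′} e
    with s≡ , j≡ ← letter-unique {s} {j} {s′} {j′}
                     (+-cancelˡ-≡ n _ _ (trans (sym (+-assoc n (s * n) (toℕ j))) (trans e (+-assoc n (s′ * n) (toℕ j′))))) =
    cong suc s≡ , j≡

  orthogonal⇒ : ∀ i → Orthogonal i → d < blockMode i
  orthogonal⇒ i (j , dot≡0) = ≤-trans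
    (≤-trans (count-blocks-≥ (λ k → tabulate (letter (select i k))) (letter zero j)
               λ k → count-tabulate-1≤ (letter (select i k)) _ j (toℕ-injective (letter≡ k)))
             (≤-reflexive (sym (occ-block i (letter zero j)))))
    (occ≤modeFreq (Vec.fromList text) _ _ (letter zero j))
    where
    dot : ∀ k → toℕ (bit i k) * toℕ (bit j k) ≡ 0
    dot zero    = refl
    dot (suc k) = dot≡0⇒ (lookup A i) (lookup A j) dot≡0 k
    shared≡0 : ∀ k → shared (select i k) j ≡ 0
    -- A 0 of vector i selects S 0, made of common letters; at a 1, orthogonality makes the bit of
    -- vector j vanish.
    shared≡0 k with bit i k | dot k
    ... | zero     | _ = refl
    ... | suc zero | e = cong (_* toℕ k) (trans (sym (+-identityʳ _)) e)
    letter≡ : ∀ k → toℕ (letter (select i k) j) ≡ toℕ (letter zero j)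
    letter≡ k = trans (toℕ-letter (select i k) j) (trans (cong (λ s → s * n + toℕ j) (shared≡0 k)) (sym (toℕ-letter zero j)))

  -- Frequency d + 1 puts the mode into each of the d + 1 strings of the block, in particular into
  -- the one for k = 0. That one is S 0 thanks to the added coordinate, so the mode is the common
  -- letter of some vector j.
  orthogonal⇐ : ∀ i → d < blockMode i → Orthogonal i
  orthogonal⇐ i d< with c , occ≡ ← modeFreq-attained (Vec.fromList text) _ _ (≤-trans (s≤s z≤n) d<) =
    orthogonal (count-tabulate-∈ (letter zero) c (full zero))
    where
    injective : ∀ k j j′ → letter k j ≡ letter k j′ → j ≡ j′
    injective k j j′ e = proj₂ (letter-unique {shared k j} {j} {shared k j′} (trans (sym (toℕ-letter k j)) (trans (cong toℕ e) (toℕ-letter k j′))))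
    full : ∀ k → 1 ≤ count c (tabulate (letter (select i k)))
    full = count-blocks-full (λ k → tabulate (letter (select i k))) c (λ k → count-tabulate-≤1 _ c (injective (select i k)))
             (≤-trans d< (≤-reflexive (trans (sym occ≡) (occ-block i c))))
    orthogonal : (∃[ j ] letter zero j ≡ c) → Orthogonal i
    orthogonal (j , j≡c) = j , dot≡0⇐ (lookup A i) (lookup A j) λ k → dot k (count-tabulate-∈ (letter (select i (suc k))) c (full (suc k)))
      where
      dot : ∀ k → (∃[ j′ ] letter (select i (suc k)) j′ ≡ c) → toℕ (bit i (suc k)) * toℕ (bit j (suc k)) ≡ 0
      dot k (j′ , j′≡c) with bit i (suc k) | letter-unique {shared (select i (suc k)) j′} {j′} {0} {j}
                              (trans (sym (toℕ-letter (select i (suc k)) j′)) (trans (cong toℕ (trans j′≡c (sym j≡c))) (toℕ-letter zero j)))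
      ... | zero     | _           = refl
      -- Here S (k + 1) itself was chosen, and it contains the common letter of j only if the bit of
      -- j vanishes, k + 1 being nonzero.
      ... | suc zero | s≡0 , refl = trans (+-identityʳ _) (m*n≡0⇒m≡0 (toℕ (bit j (suc k))) (suc (toℕ k)) s≡0)

-- Logarithms and inequalities between powers

⌊log₂⌋-upper : ∀ e x → x < 2 ^ suc e → ⌊log₂ x ⌋ ≤ e
⌊log₂⌋-upper zero    0             _             = z≤n
⌊log₂⌋-upper zero    1             _             = z≤n
⌊log₂⌋-upper zero    (suc (suc x)) (s≤s (s≤s ()))
⌊log₂⌋-upper (suc e) x x< = begin
  ⌊log₂ x ⌋             ≤⟨ m≤n+m∸n ⌊log₂ x ⌋ 1 ⟩
  1 + (⌊log₂ x ⌋ ∸ 1)   ≡⟨ cong suc (⌊log₂⌊n/2⌋⌋≡⌊log₂n⌋∸1 x) ⟨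
  1 + ⌊log₂ ⌊ x /2⌋ ⌋   ≤⟨ s≤s (⌊log₂⌋-upper e ⌊ x /2⌋ half<) ⟩
  suc e                 ∎
  where
  open ≤-Reasoning
  P = 2 ^ suc e
  half< : ⌊ x /2⌋ < P
  half< = ≤-trans (⌊n/2⌋-mono (s≤s (≤-trans x< (≤-reflexive (cong (P +_) (+-identityʳ P))))))
                  (≤-reflexive (sym (n≡⌈n+n/2⌉ P)))

⌊log₂⌋-lower : ∀ e x → 2 ^ e ≤ x → e ≤ ⌊log₂ x ⌋
⌊log₂⌋-lower e x ≤x = ≤-trans (≤-reflexive (sym (⌊log₂[2^n]⌋≡n e))) (⌊log₂⌋-mono-≤ ≤x)

⌊log₂⌋-unique : ∀ e x → 2 ^ e ≤ x → x < 2 ^ suc e → ⌊log₂ x ⌋ ≡ e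
⌊log₂⌋-unique e x ≤x x< = ≤-antisym (⌊log₂⌋-upper e x x<) (⌊log₂⌋-lower e x ≤x)

n<2^[1+⌊log₂n⌋] : ∀ n → n < 2 ^ suc ⌊log₂ n ⌋
n<2^[1+⌊log₂n⌋] n = ≰⇒> λ ≤n → <-irrefl refl (⌊log₂⌋-lower (suc ⌊log₂ n ⌋) n ≤n)

-- Suppose n < 2 ^ L for L the logarithm. Then L = 0 contradicts n ≥ 1, and L ≥ 1 makes the
-- logarithm at most L - 1. Naming L separately permits this case distinction.
2^⌊log₂n⌋≤n : ∀ n → 1 ≤ n → 2 ^ ⌊log₂ n ⌋ ≤ n
2^⌊log₂n⌋≤n n 1≤n = ≮⇒≥ (lemma ⌊log₂ n ⌋ refl)
  where
  lemma : ∀ L → ⌊log₂ n ⌋ ≡ L → n ≮ 2 ^ L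
  lemma zero    _ n<1 = <⇒≱ n<1 1≤n
  lemma (suc L) e n<  = <-irrefl refl (≤-trans (≤-reflexive (sym e)) (⌊log₂⌋-upper L n n<))

⌈log₂⌉-upper : ∀ n → ⌈log₂ n ⌉ ≤ suc ⌊log₂ n ⌋
⌈log₂⌉-upper n = ≤-trans (⌈log₂⌉-mono-≤ (<⇒≤ (n<2^[1+⌊log₂n⌋] n))) (≤-reflexive (⌈log₂2^n⌉≡n (suc ⌊log₂ n ⌋)))

n<2^n : ∀ n → n < 2 ^ n
n<2^n zero    = s≤s z≤n
n<2^n (suc n) = begin
  suc (suc n)     ≤⟨ s≤s (n<2^n n) ⟩
  1 + 2 ^ n       ≤⟨ +-mono-≤ (m^n>0 2 n) (≤-reflexive (sym (+-identityʳ (2 ^ n)))) ⟩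
  2 ^ suc n       ∎
  where open ≤-Reasoning

^-distribʳ-* : ∀ m n o → (m * n) ^ o ≡ m ^ o * n ^ o
^-distribʳ-* m n zero    = refl
^-distribʳ-* m n (suc o) = trans (cong (m * n *_) (^-distribʳ-* m n o)) (lemma m n (m ^ o) (n ^ o))
  where
  lemma : ∀ a b c d → a * b * (c * d) ≡ a * c * (b * d)
  lemma = solve-∀

1≤^ : ∀ {m} n → 1 ≤ m → 1 ≤ m ^ n
1≤^ {m} n 1≤m = ≤-trans (≤-reflexive (sym (^-zeroˡ n))) (^-monoˡ-≤ n 1≤m)

m≤m^n : ∀ {m n} → 1 ≤ m → 1 ≤ n → m ≤ m ^ n
m≤m^n {m} {suc n} 1≤m _ = ≤-trans (≤-reflexive (sym (*-identityʳ m))) (*-monoʳ-≤ m (1≤^ n 1≤m))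

-- With L = E u + r and r < E, L + 1 is at most E (u + 1) ≤ E 2 ^ u.
polylog≤ : ∀ E L → 1 ≤ E → suc L ^ E ≤ E ^ E * 2 ^ L
polylog≤ E@(suc _) L _ = begin
  suc L ^ E              ≤⟨ ^-monoˡ-≤ E (begin
    suc L                  ≡⟨ cong suc (m≡m%n+[m/n]*n L E) ⟩
    suc (L % E) + L / E * E ≤⟨ +-monoˡ-≤ _ (m%n<n L E) ⟩
    suc (L / E) * E        ≡⟨ *-comm (suc (L / E)) E ⟩
    E * suc (L / E)        ≤⟨ *-monoʳ-≤ E (n<2^n (L / E)) ⟩
    E * 2 ^ (L / E)        ∎) ⟩
  (E * 2 ^ (L / E)) ^ E  ≡⟨ ^-distribʳ-* E (2 ^ (L / E)) E ⟩
  E ^ E * (2 ^ (L / E)) ^ E ≡⟨ cong (E ^ E *_) (^-*-assoc 2 (L / E) E) ⟩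
  E ^ E * 2 ^ (L / E * E) ≤⟨ *-monoʳ-≤ (E ^ E) (^-monoʳ-≤ 2 (m/n*n≤m L E)) ⟩
  E ^ E * 2 ^ L          ∎
  where open ≤-Reasoning

-- x ^ q * n ≤ X ^ q stands for x ≤ X / n ^ (1 / q).
power-sum : ∀ {q n} x y z {X Y Z} → x ^ q * n ≤ X ^ q → y ^ q * n ≤ Y ^ q → z ^ q * n ≤ Z ^ q →
            (x + y + z) ^ q * n ≤ (3 * (X + Y + Z)) ^ q
power-sum {q} {n} x y z {X} {Y} {Z} x≤ y≤ z≤ = begin
  (x + y + z) ^ q * n     ≤⟨ *-monoˡ-≤ n (^-monoˡ-≤ q sum≤) ⟩
  (3 * (x ⊔ y ⊔ z)) ^ q * n ≡⟨ cong (_* n) (^-distribʳ-* 3 (x ⊔ y ⊔ z) q) ⟩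
  3 ^ q * (x ⊔ y ⊔ z) ^ q * n ≡⟨ *-assoc (3 ^ q) _ n ⟩
  3 ^ q * ((x ⊔ y ⊔ z) ^ q * n) ≤⟨ *-monoʳ-≤ (3 ^ q) max≤ ⟩
  3 ^ q * (X + Y + Z) ^ q ≡⟨ ^-distribʳ-* 3 (X + Y + Z) q ⟨
  (3 * (X + Y + Z)) ^ q   ∎
  where
  open ≤-Reasoning
  S = X + Y + Z
  -- Bounds on q-th powers do not add up, but they pass to the maximum, which is one of the three
  -- terms; this costs the factor 3.
  sum≤ : x + y + z ≤ 3 * (x ⊔ y ⊔ z)
  sum≤ = ≤-trans (+-mono-≤ (+-mono-≤ (≤-trans (m≤m⊔n x y) (m≤m⊔n _ z)) (≤-trans (m≤n⊔m x y) (m≤m⊔n _ z))) (m≤n⊔m (x ⊔ y) z))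
                 (≤-reflexive (lemma (x ⊔ y ⊔ z)))
    where
    lemma : ∀ m → m + m + m ≡ 3 * m
    lemma = solve-∀
  from : ∀ {u U} → U ≤ S → u ^ q * n ≤ U ^ q → u ^ q * n ≤ S ^ q
  from U≤S u≤ = ≤-trans u≤ (^-monoˡ-≤ q U≤S)
  max≤ : (x ⊔ y ⊔ z) ^ q * n ≤ S ^ q
  max≤ with ⊔-sel (x ⊔ y) z
  ... | inj₂ e rewrite e = from {z} (m≤n+m Z (X + Y)) z≤
  ... | inj₁ e rewrite e with ⊔-sel x y
  ...   | inj₁ e′ rewrite e′ = from {x} (≤-trans (m≤m+n X Y) (m≤m+n (X + Y) Z)) x≤
  ...   | inj₂ e′ rewrite e′ = from {y} (≤-trans (m≤n+m Y X) (m≤m+n (X + Y) Z)) y≤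

-- A polylogarithmic factor is absorbed by halving the exponent saved.
absorb-polylog : ∀ {q h E n x} L → 1 ≤ q → 1 ≤ h → 1 ≤ E → 1 ≤ n → 2 ^ L ≤ n →
                 x ^ q * n ≤ (E * suc L ^ h * n ^ 2) ^ q →
                 let r = h * (q + q) in
                 x ^ (q + q) * n ^ 1 ≤ (E * r ^ r) ^ (q + q) * n ^ (2 * (q + q))
absorb-polylog {q} {h} {E} {n@(suc _)} {x} L 1≤q 1≤h 1≤E _ L≤ bound = *-cancelʳ-≤ _ _ n (begin
  x ^ (q + q) * n ^ 1 * n                     ≡⟨ cong (λ a → a * n ^ 1 * n) (^-distribˡ-+-* x q q) ⟩
  x ^ q * x ^ q * n ^ 1 * n                   ≡⟨ arrange₁ (x ^ q) n ⟩
  -- The hypothesis is used squared. Of the two factors n on the left one remains as the saving, and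
  -- the other is cancelled against the bound for the logarithm.
  (x ^ q * n) * (x ^ q * n)                   ≤⟨ *-mono-≤ bound bound ⟩
  (E * suc L ^ h * n ^ 2) ^ q * (E * suc L ^ h * n ^ 2) ^ q ≡⟨ ^-distribˡ-+-* (E * suc L ^ h * n ^ 2) q q ⟨
  (E * suc L ^ h * n ^ 2) ^ (q + q)           ≡⟨ ^-distribʳ-* (E * suc L ^ h) (n ^ 2) (q + q) ⟩
  (E * suc L ^ h) ^ (q + q) * (n ^ 2) ^ (q + q) ≡⟨ cong₂ _*_ (^-distribʳ-* E (suc L ^ h) (q + q)) (^-*-assoc n 2 (q + q)) ⟩
  E ^ (q + q) * (suc L ^ h) ^ (q + q) * n ^ (2 * (q + q)) ≡⟨ cong (λ a → E ^ (q + q) * a * n ^ (2 * (q + q))) (^-*-assoc (suc L) h (q + q)) ⟩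
  E ^ (q + q) * suc L ^ r * n ^ (2 * (q + q)) ≤⟨ *-monoˡ-≤ (n ^ (2 * (q + q))) (*-monoʳ-≤ (E ^ (q + q)) log≤) ⟩
  -- The constant is raised to the power q + q only so that it can join E under a common exponent.
  E ^ (q + q) * (r ^ r * n) * n ^ (2 * (q + q)) ≤⟨ *-monoˡ-≤ (n ^ (2 * (q + q))) (*-monoʳ-≤ (E ^ (q + q)) (*-monoˡ-≤ n (m≤m^n (1≤^ r 1≤r) 1≤q+q))) ⟩
  E ^ (q + q) * ((r ^ r) ^ (q + q) * n) * n ^ (2 * (q + q)) ≡⟨ arrange₂ (E ^ (q + q)) ((r ^ r) ^ (q + q)) n (n ^ (2 * (q + q))) ⟩
  E ^ (q + q) * (r ^ r) ^ (q + q) * n ^ (2 * (q + q)) * n ≡⟨ cong (λ a → a * n ^ (2 * (q + q)) * n) (^-distribʳ-* E (r ^ r) (q + q)) ⟨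
  (E * r ^ r) ^ (q + q) * n ^ (2 * (q + q)) * n ∎)
  where
  open ≤-Reasoning
  r = h * (q + q)
  1≤q+q : 1 ≤ q + q
  1≤q+q = ≤-trans 1≤q (m≤m+n q q)
  1≤r : 1 ≤ r
  1≤r = *-mono-≤ 1≤h 1≤q+q
  log≤ : suc L ^ r ≤ r ^ r * n
  log≤ = ≤-trans (polylog≤ r L 1≤r) (*-monoʳ-≤ (r ^ r) L≤)
  arrange₁ : ∀ a b → a * a * (b * 1) * b ≡ a * b * (a * b)
  arrange₁ = solve-∀
  arrange₂ : ∀ a b c d → a * (b * c) * d ≡ a * b * d * c
  arrange₂ = solve-∀

-- Choice of the alphabet size, and the total time

module Parameters (a c : ℕ) where

  -- Chosen for `N<Q`: since N ≤ (c + 1) p ^ 3 and (30 + a ^ 2) (c + 1) < 2 ^ surplus ≤ p ^ surplus,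
  -- the multiple (30 + a ^ 2) N stays below p ^ exponent. The 30 leaves room for the sizes that
  -- must fit in a word; a ^ 2 serves the condition on the alphabet.
  surplus exponent : ℕ
  surplus  = (30 + a ^ 2) * suc c
  exponent = surplus + 3

  module Sizes {n d L : ℕ} (2≤n : 2 ≤ n) (1≤d : 1 ≤ d) (≤n : 2 ^ L ≤ n) (n< : n < 2 ^ suc L) (d≤ : d ≤ c * suc L) where

    -- `y` is the order of the grammar size and of the input length, hence the unit of the estimates
    -- below; `N`, which is y n, is the length of the text.
    p Q σ y N : ℕ
    p = 2 ^ suc L
    Q = p ^ exponent
    σ = n * Q
    y = n * suc d
    N = n * (suc d * n)

    1≤n : 1 ≤ n
    1≤n = ≤-trans (s≤s z≤n) 2≤n

    1≤Q : 1 ≤ Q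
    1≤Q = 1≤^ exponent (m^n>0 2 (suc L))

    suc-d≤ : suc d ≤ suc c * suc L
    suc-d≤ = +-mono-≤ (s≤s (z≤n {L})) d≤

    n≤y : n ≤ y
    n≤y = ≤-trans (≤-reflexive (sym (*-identityʳ n))) (*-monoʳ-≤ n (s≤s z≤n))

    suc-d≤y : suc d ≤ y
    suc-d≤y = ≤-trans (≤-reflexive (sym (*-identityˡ (suc d)))) (*-monoˡ-≤ (suc d) 1≤n)

    1≤y : 1 ≤ y
    1≤y = ≤-trans 1≤n n≤y

    y*n≡N : y * n ≡ N
    y*n≡N = *-assoc n (suc d) n

    y≤N : y ≤ N
    y≤N = ≤-trans (≤-reflexive (sym (*-identityʳ y))) (≤-trans (*-monoʳ-≤ y 1≤n) (≤-reflexive y*n≡N))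

    2≤N : 2 ≤ N
    2≤N = ≤-trans 2≤n (≤-trans n≤y y≤N)

    N<Q : (30 + a ^ 2) * N < Q
    N<Q = begin-strict
      (30 + a ^ 2) * N                              ≤⟨ *-monoʳ-≤ (30 + a ^ 2) (*-mono-≤ (<⇒≤ n<) (*-mono-≤ (≤-trans suc-d≤ (*-monoʳ-≤ (suc c) (<⇒≤ (n<2^n (suc L))))) (<⇒≤ n<))) ⟩
      (30 + a ^ 2) * (p * (suc c * p * p))          ≡⟨ arrange (30 + a ^ 2) p (suc c) ⟩
      surplus * (p * (p * (p * 1)))                 <⟨ *-monoˡ-< (p ^ 3) {{>-nonZero (1≤^ 3 (m^n>0 2 (suc L)))}} (<-≤-trans (n<2^n surplus) (^-monoˡ-≤ surplus 2≤p)) ⟩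
      p ^ surplus * p ^ 3                           ≡⟨ ^-distribˡ-+-* p surplus 3 ⟨
      Q                                             ∎
      where
      open ≤-Reasoning
      2≤p : 2 ≤ p
      2≤p = ^-monoʳ-≤ 2 {1} {suc L} (s≤s z≤n)
      arrange : ∀ u v w → u * (v * (w * v * v)) ≡ u * w * (v * (v * (v * 1)))
      arrange = solve-∀

    30N<Q : 30 * N < Q
    30N<Q = ≤-<-trans (*-monoˡ-≤ N (m≤m+n 30 (a ^ 2))) N<Q

    small : ∀ {x} → x ≤ 30 * N → x < Q
    small x≤ = ≤-<-trans x≤ 30N<Q

    Q≤σ : Q ≤ σ
    Q≤σ = ≤-trans (≤-reflexive (sym (*-identityˡ Q))) (*-monoˡ-≤ Q 1≤n)

    small≤σ : ∀ {x} → x ≤ 30 * N → x ≤ σ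
    small≤σ x≤ = ≤-trans (<⇒≤ (small x≤)) Q≤σ

    multiple : ∀ k {x} {k≤ : True (k ≤? 30)} → x ≤ k * y → x ≤ 30 * N
    multiple k {k≤ = k≤} x≤ = ≤-trans x≤ (*-mono-≤ (toWitness k≤) y≤N)

    pQ≡ : p * Q ≡ 2 ^ (suc exponent * suc L)
    pQ≡ = trans (^-*-assoc 2 (suc L) (suc exponent)) (cong (2 ^_) (*-comm (suc L) (suc exponent)))

    σ+<pQ : ∀ {x} → x ≤ 30 * N → x + σ < p * Q
    σ+<pQ {x} x≤ = <-≤-trans (+-monoˡ-< σ (small x≤)) (*-monoˡ-≤ Q n<)

    length≤ : 4 + (n * 2 + (n * (1 + suc d * 2) + (suc d * (1 + n * 2) + 0))) ≤ 12 * y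
    length≤ = begin
      4 + (n * 2 + (n * (1 + suc d * 2) + (suc d * (1 + n * 2) + 0))) ≡⟨ split n (suc d) ⟩
      4 * 1 + 3 * n + suc d + 4 * y                                   ≤⟨ +-monoˡ-≤ (4 * y) (+-mono-≤ (+-mono-≤ (*-monoʳ-≤ 4 1≤y) (*-monoʳ-≤ 3 n≤y)) suc-d≤y) ⟩
      4 * y + 3 * y + y + 4 * y                                       ≡⟨ collect y ⟩
      12 * y                                                          ∎
      where
      open ≤-Reasoning
      split : ∀ u v → 4 + (u * 2 + (u * (1 + v * 2) + (v * (1 + u * 2) + 0))) ≡ 4 * 1 + 3 * u + v + 4 * (u * v)
      split = solve-∀
      collect : ∀ u → 4 * u + 3 * u + u + 4 * u ≡ 12 * u
      collect = solve-∀

    size≤ : (n ⊔ 1) + (n * (suc d ⊔ 1) + suc d * (n ⊔ 1)) ≤ 3 * y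
    size≤ rewrite m≥n⇒m⊔n≡m 1≤n | ⊔-identityʳ d = ≤-trans (+-monoˡ-≤ _ n≤y) (≤-reflexive (collect n (suc d)))
      where
      collect : ∀ u v → u * v + (u * v + v * u) ≡ 3 * (u * v)
      collect = solve-∀

    n≤size : n ≤ (n ⊔ 1) + (n * (suc d ⊔ 1) + suc d * (n ⊔ 1))
    n≤size = ≤-trans (m≤m⊔n n 1) (m≤m+n (n ⊔ 1) _)

    2+n*d≤ : 2 + n * d ≤ 4 + (n * 2 + (n * (1 + suc d * 2) + (suc d * (1 + n * 2) + 0)))
    2+n*d≤ = +-mono-≤ {2} {4} (s≤s (s≤s z≤n)) (≤-trans (*-monoʳ-≤ n (≤-trans (n≤1+n d) (≤-trans (m≤m*n (suc d) 2) (n≤1+n _)))) (≤-trans (m≤m+n (n * (1 + suc d * 2)) _) (m≤n+m _ (n * 2))))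

    rules≤ : suc n + suc d ≤ 3 * y
    rules≤ = ≤-trans (+-mono-≤ (+-mono-≤ 1≤y n≤y) suc-d≤y) (≤-reflexive (collect y))
      where
      collect : ∀ u → u + u + u ≡ 3 * u
      collect = solve-∀

    block≤ : suc (suc d * n) ≤ 2 * y
    block≤ = ≤-trans (+-mono-≤ 1≤y (≤-reflexive (*-comm (suc d) n))) (≤-reflexive (cong (y +_) (sym (+-identityʳ y))))

    2+[1+n]*d≤ : 2 + suc n * d ≤ 4 * y
    2+[1+n]*d≤ = ≤-trans (+-mono-≤ (*-monoʳ-≤ 2 1≤y) (≤-trans (*-monoʳ-≤ (suc n) (n≤1+n d)) (+-monoˡ-≤ y suc-d≤y))) (≤-reflexive (collect y))
      where
      collect : ∀ u → 2 * u + (u + u) ≡ 4 * u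
      collect = solve-∀

    -- From 2 ^ L ≤ n follows 2 ^ L Q ≤ σ. Since x < Q, adding x raises σ = n Q to less than (n + 1)
    -- Q, which is at most p Q. With p = 2 ^ (L + 1) and Q = p ^ exponent, both ends are powers of 2
    -- with consecutive exponents.
    log-word : ∀ {x} → x ≤ 30 * N → suc ⌊log₂ x + σ ⌋ ≡ suc exponent * suc L
    log-word {x} x≤ = cong suc (⌊log₂⌋-unique (L + exponent * suc L) (x + σ)
      (begin
        2 ^ (L + exponent * suc L)     ≡⟨ ^-distribˡ-+-* 2 L (exponent * suc L) ⟩
        2 ^ L * 2 ^ (exponent * suc L) ≡⟨ cong (λ e → 2 ^ L * 2 ^ e) (*-comm exponent (suc L)) ⟩
        2 ^ L * 2 ^ (suc L * exponent) ≡⟨ cong (2 ^ L *_) (^-*-assoc 2 (suc L) exponent) ⟨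
        2 ^ L * Q                      ≤⟨ *-monoˡ-≤ Q ≤n ⟩
        σ                              ≤⟨ m≤n+m σ x ⟩
        x + σ                          ∎)
      (<-≤-trans (σ+<pQ x≤) (≤-reflexive pQ≡)))
      where open ≤-Reasoning

    log-N≤ : ⌊log₂ N ⌋ ≤ suc exponent * suc L
    log-N≤ = ⌊log₂⌋-upper _ N (<-≤-trans (small (m≤m+n N (29 * N)))
      (≤-trans (m≤n*m Q (2 * p) {{>-nonZero (*-mono-≤ (s≤s (z≤n {1})) (m^n>0 2 (suc L)))}})
               (≤-reflexive (trans (*-assoc 2 p Q) (cong (2 *_) pQ≡)))))

    -- σ exceeds a ^ 2 N even without being squared, and the logarithm is at least 1 because N ≥ 2.
    large-alphabet : ∀ b → 1 ≤ b → a ^ 2 * N ≤ b ^ 2 * σ ^ 2 * ⌊log₂ N ⌋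
    large-alphabet b 1≤b = begin
      a ^ 2 * N                  ≤⟨ *-monoˡ-≤ N (m≤n+m (a ^ 2) 30) ⟩
      (30 + a ^ 2) * N           ≤⟨ <⇒≤ N<Q ⟩
      Q                          ≤⟨ Q≤σ ⟩
      σ                          ≤⟨ m≤m^n {n = 2} (≤-trans 1≤Q Q≤σ) (s≤s z≤n) ⟩
      σ ^ 2                      ≡⟨ trans (*-identityʳ _) (*-identityˡ _) ⟨
      1 * σ ^ 2 * 1              ≤⟨ *-mono-≤ (*-monoˡ-≤ (σ ^ 2) (1≤^ 2 1≤b)) (⌊log₂⌋-lower 1 N 2≤N) ⟩
      b ^ 2 * σ ^ 2 * ⌊log₂ N ⌋  ∎
      where open ≤-Reasoning

  module Time (A B₁ e₁ B₂ e₂ : ℕ) where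

    -- With λ = L + 1, preprocessing, construction and queries are all brought to the form X λ ^ h n
    -- ^ 2. The grammar size contributes one λ to a query and two to the construction, on top of the
    -- given powers of log N ≤ m λ; `h` covers both.
    m h X₁ X₂ X₃ factor : ℕ
    m      = suc exponent
    h      = e₁ + e₂ + 2
    X₁     = suc A * suc c
    X₂     = B₁ * m ^ e₁ * (3 * suc c) ^ 2
    X₃     = B₂ * m ^ e₂ * (3 * suc c)
    factor = 3 * (X₁ + X₂ + X₃)

    constant : ℕ → ℕ
    constant q = factor * (h * (q + q)) ^ (h * (q + q))

    total-time : ∀ {n d L q e g l t t₁ t₂} → 1 ≤ q → 1 ≤ e → 1 ≤ n → 2 ^ L ≤ n → d ≤ c * suc L → l ≤ m * suc L →
      n ≤ g → g ≤ 3 * (n * suc d) →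
      t₁ ^ q * g ^ e ≤ (B₁ * l ^ e₁) ^ q * g ^ (2 * q) →
      t₂ ^ q * g ^ e ≤ (B₂ * l ^ e₂) ^ q * g ^ (1 * q) →
      t ≤ A * (n * suc d) + t₁ + n * t₂ →
      t ^ (q + q) * n ^ 1 ≤ constant q ^ (q + q) * n ^ (2 * (q + q))
    total-time {n} {d} {L} {q} {e} {g} {l} {t} {t₁} {t₂} 1≤q 1≤e 1≤n 2^L≤n d≤ l≤ n≤g g≤ t₁≤ t₂≤ t≤ =
      absorb-polylog {q} {h} {factor} {n} {t} L 1≤q (m≤n+m 1 (e₁ + e₂ + 1) ∙ ≤-reflexive (+-assoc (e₁ + e₂) 1 1)) 1≤factor 1≤n 2^L≤n
        (*-monoˡ-≤ n (^-monoˡ-≤ q t≤) ∙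
         power-sum {q} {n} (A * (n * suc d)) t₁ (n * t₂) {T X₁} {T X₂} {T X₃} first second third ∙
         ≤-reflexive (cong (_^ q) (factor-out X₁ X₂ X₃ (λ′ ^ h) (n ^ 2))))
      where
      open ≤-Reasoning
      infixr 2 _∙_
      _∙_ : ∀ {i j k} → i ≤ j → j ≤ k → i ≤ k
      _∙_ = ≤-trans
      λ′ : ℕ
      λ′ = suc L
      T : ℕ → ℕ
      T X = X * λ′ ^ h * n ^ 2
      1≤factor : 1 ≤ factor
      1≤factor = s≤s z≤n
      factor-out : ∀ x y z u v → 3 * (x * u * v + y * u * v + z * u * v) ≡ 3 * (x + y + z) * u * v
      factor-out = solve-∀
      y≤ : n * suc d ≤ suc c * λ′ * n
      y≤ = *-monoʳ-≤ n (+-mono-≤ (s≤s (z≤n {L})) d≤) ∙ ≤-reflexive (*-comm n _)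
      g≤′ : g ≤ 3 * suc c * λ′ * n
      g≤′ = g≤ ∙ *-monoʳ-≤ 3 y≤ ∙ ≤-reflexive (arrange (suc c) λ′ n)
        where
        arrange : ∀ u v w → 3 * (u * v * w) ≡ 3 * u * v * w
        arrange = solve-∀
      -- Reduces the saving from e / q to 1 / q in the exponent, and from a power of |G| to one of
      -- n.
      n≤g^e : n ≤ g ^ e
      n≤g^e = n≤g ∙ m≤m^n (1≤n ∙ n≤g) 1≤e
      log≤ : ∀ i → l ^ i ≤ m ^ i * λ′ ^ i
      log≤ i = ^-monoˡ-≤ i l≤ ∙ ≤-reflexive (^-distribʳ-* m λ′ i)
      first : (A * (n * suc d)) ^ q * n ≤ T X₁ ^ q
      first = begin
        -- Preprocessing is almost linear, so a whole factor n, that is n ^ q under the power, is to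
        -- spare.
        (A * (n * suc d)) ^ q * n      ≤⟨ *-monoʳ-≤ ((A * (n * suc d)) ^ q) (m≤m^n 1≤n 1≤q) ⟩
        (A * (n * suc d)) ^ q * n ^ q  ≡⟨ ^-distribʳ-* (A * (n * suc d)) n q ⟨
        (A * (n * suc d) * n) ^ q      ≤⟨ ^-monoˡ-≤ q (begin
          A * (n * suc d) * n            ≤⟨ *-monoˡ-≤ n (*-mono-≤ (n≤1+n A) y≤) ⟩
          suc A * (suc c * λ′ * n) * n   ≡⟨ arrange (suc A) (suc c) λ′ n ⟩
          X₁ * λ′ * n ^ 2                ≤⟨ *-monoˡ-≤ (n ^ 2) (*-monoʳ-≤ X₁ (m≤m^n (s≤s z≤n) (m≤n+m 1 (e₁ + e₂ + 1) ∙ ≤-reflexive (+-assoc (e₁ + e₂) 1 1)))) ⟩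
          T X₁                           ∎) ⟩
        T X₁ ^ q                       ∎
        where
        arrange : ∀ u v w z → u * (v * w * z) * z ≡ u * v * w * (z * (z * 1))
        arrange = solve-∀
      second : t₁ ^ q * n ≤ T X₂ ^ q
      second = begin
        t₁ ^ q * n                          ≤⟨ *-monoʳ-≤ (t₁ ^ q) n≤g^e ⟩
        t₁ ^ q * g ^ e                      ≤⟨ t₁≤ ⟩
        (B₁ * l ^ e₁) ^ q * g ^ (2 * q)     ≡⟨ cong ((B₁ * l ^ e₁) ^ q *_) (^-*-assoc g 2 q) ⟨
        (B₁ * l ^ e₁) ^ q * (g ^ 2) ^ q     ≡⟨ ^-distribʳ-* (B₁ * l ^ e₁) (g ^ 2) q ⟨
        (B₁ * l ^ e₁ * g ^ 2) ^ q           ≤⟨ ^-monoˡ-≤ q (begin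
          B₁ * l ^ e₁ * g ^ 2                 ≤⟨ *-mono-≤ (*-monoʳ-≤ B₁ (log≤ e₁)) (^-monoˡ-≤ 2 g≤′) ⟩
          B₁ * (m ^ e₁ * λ′ ^ e₁) * (3 * suc c * λ′ * n) ^ 2 ≡⟨ arrange B₁ (m ^ e₁) (λ′ ^ e₁) (3 * suc c) λ′ n ⟩
          X₂ * (λ′ ^ e₁ * λ′ ^ 2) * n ^ 2     ≡⟨ cong (λ u → X₂ * u * n ^ 2) (^-distribˡ-+-* λ′ e₁ 2) ⟨
          X₂ * λ′ ^ (e₁ + 2) * n ^ 2          ≤⟨ *-monoˡ-≤ (n ^ 2) (*-monoʳ-≤ X₂ (^-monoʳ-≤ λ′ (+-monoˡ-≤ 2 (m≤m+n e₁ e₂)))) ⟩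
          T X₂                                ∎) ⟩
        T X₂ ^ q                            ∎
        where
        arrange : ∀ b u v w x z → b * (u * v) * (w * x * z * (w * x * z * 1)) ≡ b * u * (w * (w * 1)) * (v * (x * (x * 1))) * (z * (z * 1))
        arrange = solve-∀
      third : (n * t₂) ^ q * n ≤ T X₃ ^ q
      third = begin
        (n * t₂) ^ q * n                        ≤⟨ *-monoʳ-≤ ((n * t₂) ^ q) n≤g^e ⟩
        (n * t₂) ^ q * g ^ e                    ≡⟨ cong (_* g ^ e) (^-distribʳ-* n t₂ q) ⟩
        n ^ q * t₂ ^ q * g ^ e                  ≡⟨ *-assoc (n ^ q) (t₂ ^ q) (g ^ e) ⟩
        n ^ q * (t₂ ^ q * g ^ e)                ≤⟨ *-monoʳ-≤ (n ^ q) t₂≤ ⟩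
        n ^ q * ((B₂ * l ^ e₂) ^ q * g ^ (1 * q)) ≡⟨ cong (λ i → n ^ q * ((B₂ * l ^ e₂) ^ q * g ^ i)) (*-identityˡ q) ⟩
        n ^ q * ((B₂ * l ^ e₂) ^ q * g ^ q)     ≡⟨ cong (n ^ q *_) (^-distribʳ-* (B₂ * l ^ e₂) g q) ⟨
        n ^ q * (B₂ * l ^ e₂ * g) ^ q           ≡⟨ ^-distribʳ-* n (B₂ * l ^ e₂ * g) q ⟨
        (n * (B₂ * l ^ e₂ * g)) ^ q             ≤⟨ ^-monoˡ-≤ q (begin
          n * (B₂ * l ^ e₂ * g)                   ≤⟨ *-monoʳ-≤ n (*-mono-≤ (*-monoʳ-≤ B₂ (log≤ e₂)) g≤′) ⟩
          n * (B₂ * (m ^ e₂ * λ′ ^ e₂) * (3 * suc c * λ′ * n)) ≡⟨ arrange B₂ (m ^ e₂) (λ′ ^ e₂) (3 * suc c) λ′ n ⟩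
          X₃ * (λ′ ^ e₂ * λ′) * n ^ 2             ≡⟨ cong (λ u → X₃ * u * n ^ 2) (*-comm (λ′ ^ e₂) λ′) ⟩
          X₃ * λ′ ^ (1 + e₂) * n ^ 2              ≤⟨ *-monoˡ-≤ (n ^ 2) (*-monoʳ-≤ X₃ (^-monoʳ-≤ λ′ (+-mono-≤ (s≤s (z≤n {1})) (m≤n+m e₂ e₁) ∙ ≤-reflexive (+-comm 2 (e₁ + e₂))))) ⟩
          T X₃                                    ∎) ⟩
        T X₃ ^ q                                ∎
        where
        arrange : ∀ b u v w x z → z * (b * (u * v) * (w * x * z)) ≡ b * u * w * (v * x) * (z * (z * 1))
        arrange = solve-∀

-- Computing the alphabet size and the constants

bits≤1 : ∀ {d} (x : Vec (Fin 2) d) → All (_≤ 1) (bits x)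
bits≤1 []      = All.[]
bits≤1 (b ∷ x) = bit≤1 b All.∷ bits≤1 x

matrix≤1 : ∀ {n d} (A : Vec (Vec (Fin 2) d) n) → All (_≤ 1) (concatMap bits (Vec.toList A))
matrix≤1 []      = All.[]
matrix≤1 (x ∷ A) = ++⁺ (bits≤1 x) (matrix≤1 A)

-- The power of 2 is found in n rounds, which have no effect on it once it exceeds n. This is
-- affordable and lets the counter of the loop be fixed in advance.
doubleStep doubleLoop setConstants : Program

doubleStep =
  instr (binop lt 14 1 17) ⨾
  ifnz 14 skip (instr (binop add 17 17 17) ⨾ skip) ⨾
  instr (binop sub 9 9 3) ⨾
  skip

doubleLoop =
  instr (const 17 1) ⨾
  instr (binop add 9 1 4) ⨾
  while 9 doubleStep

raise : ℕ → Program
raise zero    = skip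
raise (suc e) = instr (binop mul 5 5 17) ⨾ raise e

setConstants =
  instr (binop mul 18 1 2) ⨾
  instr (const 14 2) ⨾
  instr (binop add 18 14 18) ⨾
  instr (binop add 7 3 2) ⨾
  instr (binop add 16 3 1) ⨾
  skip

module _ {w : ℕ} {P Q : Program} {r : Reg} {s : State} {T : ℕ} {R : State → Set} where

  do-if-yes : reg s r ≢ 0 → Runs w P s T R → Runs w (ifnz r P Q) s (suc T) R
  do-if-yes ≢0 (runs e t≤ q) = runs (if-yes ≢0 e) (s≤s t≤) q

  do-if-no : reg s r ≡ 0 → Runs w Q s T R → Runs w (ifnz r P Q) s (suc T) R
  do-if-no ≡0 (runs e t≤ q) = runs (if-no ≡0 e) (s≤s t≤) q

module Setup (w n d : ℕ) (D : ℕ → ℕ) where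

  Base : State → Set
  Base s = reg s 0 ≡ 0 × reg s 1 ≡ n × reg s 2 ≡ d × reg s 3 ≡ 1 × reg s 4 ≡ 0 ×
           (∀ r → reg s (20 + r) ≡ 0) × (∀ a → mem s a ≡ D a)

  module _ (1≤n : 1 ≤ n) (2n< : n + n < 2 ^ w) where

    fit : ∀ {x} → x ≤ n + n → x < 2 ^ w
    fit x≤ = ≤-<-trans x≤ 2n<

    -- Doubling adds at least 1, which makes up for the round spent, so n < j + 2 ^ e survives and
    -- yields n < 2 ^ e at the end. The bound by n + n makes the power the least one above n.
    Doubling : ℕ → State → Set
    Doubling j s = Base s × reg s 9 ≡ j × (∃[ e ] reg s 17 ≡ 2 ^ e × n < j + 2 ^ e × 2 ^ e ≤ n + n × j ≤ n)

    doubleStep-runs : ∀ j s → Doubling (suc j) s → Runs w doubleStep s 4 (Doubling j)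
    doubleStep-runs j s (base@(_ , n≡ , _ , 1≡ , _) , j≡ , e , p≡ , n< , ≤2n , j<n) =
      do-lt n≡ p≡ (fit (+-mono-≤ 1≤n z≤n)) λ v test → do-seq {T = 2} {T′ = 1} (branch v test) λ
        { s′ (base′@(_ , _ , _ , 1≡′ , _) , j≡′ , e′ , p≡′ , n<′ , ≤2n′) →
          do-pred j≡′ 1≡′ (fit (≤-trans (≤-trans (n≤1+n j) j<n) (m≤m+n n n)))
            (do-skip (base′ , refl , e′ , p≡′ , n<′ , ≤2n′ , ≤-trans (n≤1+n j) j<n)) }
      where
      After : State → Set
      After s′ = Base s′ × reg s′ 9 ≡ suc j × (∃[ e′ ] reg s′ 17 ≡ 2 ^ e′ × n < j + 2 ^ e′ × 2 ^ e′ ≤ n + n)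
      branch : ∀ v → (v ≡ 1 × n < 2 ^ e) ⊎ (v ≡ 0 × 2 ^ e ≤ n) →
               Runs w (ifnz 14 skip (instr (binop add 17 17 17) ⨾ skip)) (setReg 14 v s) 2 After
      branch _ (inj₁ (refl , n<p)) = do-if-yes (λ ()) (do-skip (base , j≡ , e , p≡ , ≤-trans n<p (m≤n+m _ j) , ≤2n))
      branch _ (inj₂ (refl , p≤n)) =
        do-if-no refl (do-add p≡ p≡ (fit double≤)
          (do-skip (base , j≡ , suc e , double≡ , n<′ , ≤-trans (≤-reflexive (sym double≡)) double≤)))
        where
        double≤ : 2 ^ e + 2 ^ e ≤ n + n
        double≤ = +-mono-≤ p≤n p≤n
        double≡ : 2 ^ e + 2 ^ e ≡ 2 ^ suc e
        double≡ = cong (2 ^ e +_) (sym (+-identityʳ (2 ^ e)))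
        n<′ : n < j + 2 ^ suc e
        n<′ = begin-strict
          n                   <⟨ n< ⟩
          suc j + 2 ^ e       ≡⟨ +-suc j (2 ^ e) ⟨
          j + (1 + 2 ^ e)     ≤⟨ +-monoʳ-≤ j (+-monoˡ-≤ (2 ^ e) (m^n>0 2 e)) ⟩
          j + (2 ^ e + 2 ^ e) ≡⟨ cong (j +_) double≡ ⟩
          j + 2 ^ suc e       ∎
          where open ≤-Reasoning

    double-runs : ∀ s → Base s → Runs w doubleLoop s (3 + n * 5)
                    (λ s′ → Base s′ × reg s′ 17 ≡ 2 ^ suc ⌊log₂ n ⌋)
    double-runs s base@(_ , n≡ , _ , 1≡ , 0≡ , _) =
      do-const (fit (+-mono-≤ 1≤n z≤n))
      (do-add n≡ 0≡ (fit (+-monoʳ-≤ n z≤n))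
      (runs-mono ≤-refl (λ { s′ (base′ , _ , e , p≡ , n< , ≤2n , _) → base′ , trans p≡ (power e n< ≤2n) })
        (do-while Doubling 4 (λ _ _ → proj₁ ∘ proj₂) doubleStep-runs n _
          (base , +-identityʳ n , 0 , refl , m<m+n n z<s , +-mono-≤ 1≤n z≤n , ≤-refl))))
      where
      power : ∀ e → n < 2 ^ e → 2 ^ e ≤ n + n → 2 ^ e ≡ 2 ^ suc ⌊log₂ n ⌋
      power zero    n<1 _   = contradiction 1≤n (<⇒≱ n<1)
      power (suc e) n<  ≤2n = cong (λ L → 2 ^ suc L) (sym (⌊log₂⌋-unique e n (*-cancelˡ-≤ 2 (≤-trans ≤2n (≤-reflexive (cong (n +_) (sym (+-identityʳ n)))))) n<))

  raise-runs : ∀ e v p s → 1 ≤ p → Base s → reg s 5 ≡ v → reg s 17 ≡ p → v * p ^ e < 2 ^ w →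
               Runs w (raise e) s e (λ s′ → Base s′ × reg s′ 5 ≡ v * p ^ e)
  raise-runs zero    v p s 1≤p base v≡ p≡ v< = do-skip (base , trans v≡ (sym (*-identityʳ v)))
  raise-runs (suc e) v p s 1≤p base v≡ p≡ v< =
    do-mul v≡ p≡ (≤-<-trans vp≤ v<)
      (runs-mono ≤-refl (λ { s′ (base′ , σ≡) → base′ , trans σ≡ (*-assoc v p (p ^ e)) })
        (raise-runs e (v * p) p _ 1≤p base refl p≡ (≤-<-trans (≤-reflexive (*-assoc v p (p ^ e))) v<)))
    where
    vp≤ : v * p ≤ v * p ^ suc e
    vp≤ = *-monoʳ-≤ v (m≤m^n {n = suc e} 1≤p (s≤s z≤n))

  module _ {σ : ℕ} (fits : 2 + suc n * d + suc n + suc d < 2 ^ w) where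

    open Encode w n d σ D using (Env)

    private
      fit′ : ∀ {x} → x ≤ 2 + suc n * d + suc n + suc d → x < 2 ^ w
      fit′ x≤ = ≤-<-trans x≤ fits
      2+nd≤ : 2 + n * d ≤ 2 + suc n * d + suc n + suc d
      2+nd≤ = ≤-trans (+-monoʳ-≤ 2 (m≤n+m (n * d) d)) (≤-trans (m≤m+n _ (suc n)) (m≤m+n _ (suc d)))

    setConstants-runs : ∀ s → Base s → reg s 5 ≡ σ → Runs w setConstants s 5 (λ s′ → Env s′ × (∀ a → mem s′ a ≡ D a))
    setConstants-runs s base@(out≡ , n≡ , d≡ , 1≡ , 0≡ , low , mem≡) σ≡ =
      do-mul n≡ d≡ (fit′ (≤-trans (m≤n+m (n * d) 2) 2+nd≤))
      (do-const (fit′ (s≤s (s≤s z≤n)))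
      (do-add refl refl (fit′ 2+nd≤)
      (do-add 1≡ d≡ (fit′ (m≤n+m (suc d) (2 + suc n * d + suc n)))
      (do-add 1≡ n≡ (fit′ (≤-trans (m≤n+m (suc n) (2 + suc n * d)) (m≤m+n _ (suc d))))
      (do-skip ((out≡ , n≡ , d≡ , 1≡ , 0≡ , σ≡ , refl , refl , refl , low) , mem≡))))))

-- The loop of queries

advance testMode : Program

advance =
  instr (binop add 10 12 4) ⨾
  instr (binop add 12 11 12) ⨾
  instr (binop sub 9 9 3) ⨾
  skip

testMode =
  -- Register 20 is register 0 of the relocated query program, where its answer appears.
  instr (binop lt 14 2 20) ⨾
  ifnz 14 (instr (const 0 1) ⨾ skip) skip ⨾
  advance

queryStep : Program → Program
queryStep query =
  instr (binop add 20 10 4) ⨾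
  instr (binop add 21 12 4) ⨾
  shift query ⨾
  testMode

queryLoop : Program → Program
queryLoop query =
  instr (binop mul 11 7 1) ⨾
  instr (const 10 0) ⨾
  instr (binop add 12 11 4) ⨾
  instr (binop add 9 1 4) ⨾
  while 9 (queryStep query)

prepare : ℕ → Program
prepare e =
  doubleLoop ⨾
  instr (binop add 5 1 4) ⨾
  raise e ⨾
  setConstants ⨾
  encodeGrammar

readSizes : Program
readSizes =
  instr (const 3 1) ⨾
  instr (read 1 4) ⨾
  instr (read 2 3) ⨾
  instr (const 14 2) ⨾
  instr (binop lt 14 1 14) ⨾
  skip

orthogonalVectors : ℕ → Program → Program → Program
orthogonalVectors e build query =
  readSizes ⨾
  ifnz 14
    (instr (binop add 0 1 4) ⨾ skip)
    (prepare e ⨾ shift build ⨾ queryLoop query)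

module Queries {w n d σ : ℕ} {A : Vec (Vec (Fin 2) d) n} (block≤ : suc d * n ≤ σ)
               {build query : Program} {input : List ℕ} where

  open Grammar A block≤ hiding (bit; select)

  private
    b : ℕ
    b = suc d * n

  Answers : (Fast : ℕ → Set) → Set
  Answers Fast = ∀ s → Reachable w (length text) build query input s → ∀ i e → i ≤ length text → e ≤ length text →
    ∃[ t ] ∃[ s′ ] Exec w query (ask w i e s) t s′ × reg s′ 0 ≡ modeFreq (Vec.fromList text) i e × Fast t

  -- A yes is final, whereas a 0 excludes only the vectors treated so far.
  Answer : ℕ → State → Set
  Answer i s = (reg s 0 ≡ 1 × HasOrthogonalPair A) ⊎ (reg s 0 ≡ 0 × (∀ i′ → toℕ i′ < i → ¬ Orthogonal i′))

  Fixed : State → Set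
  Fixed s = reg s 1 ≡ n × reg s 2 ≡ d × reg s 3 ≡ 1 × reg s 4 ≡ 0 × reg s 11 ≡ b

  -- A query may change the data structure, so successive queries start from different states; all
  -- that persists is that the state is reachable.
  Linked : State → Set
  Linked s = ∃[ s₀ ] Reachable w (length text) build query input s₀ × Sim s₀ s

  Querying : ℕ → State → Set
  Querying j s = Fixed s × reg s 9 ≡ j ×
    (∃[ i ] i + j ≡ n × reg s 10 ≡ i * b × reg s 12 ≡ i * b + b × Linked s × Answer i s)

  module _ (Fast : ℕ → Set) (fast₀ : Fast 0) (answers : Answers Fast) (1≤n : 1 ≤ n) (fits : b + n * b < 2 ^ w) where

    fit : ∀ {x} → x ≤ b + n * b → x < 2 ^ w
    fit x≤ = ≤-<-trans x≤ fits

    -- The 8 steps around a query are two for passing the range, one for the comparison, up to two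
    -- for the branch and three for advancing.
    Step : ℕ → Set
    Step T = ∃[ t ] Fast t × T ≡ t + 8

    queryStep-runs : ∀ j s → Querying (suc j) s → ∃[ T ] Step T × Runs w (queryStep query) s T (Querying j)
    queryStep-runs j s ((n≡ , d≡ , 1≡ , 0≡ , b≡) , j≡ , i , i+j , from≡ , to≡ , (s₀ , reachable , linked) , answer)
      = query-time
      where
      i<n : i < n
      i<n = ≤-trans (m<m+n i z<s) (≤-reflexive i+j)
      vector : Fin n
      vector = fromℕ< i<n
      vector≡ : toℕ vector ≡ i
      vector≡ = toℕ-fromℕ< i<n
      to≤ : i * b + b ≤ n * b
      to≤ = ≤-trans (≤-reflexive (+-comm (i * b) b)) (*-monoˡ-≤ b i<n)
      from≤ : i * b ≤ n * b
      from≤ = ≤-trans (m≤m+n (i * b) b) to≤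
      n*b≤ : n * b ≤ b + n * b
      n*b≤ = m≤n+m (n * b) b
      s₁ : State
      s₁ = setReg 21 (i * b + b + 0) (setReg 20 (i * b + 0) s)
      asked : Sim (ask w (i * b) (i * b + b) s₀) s₁
      asked = setReg-sim {r = 1} (same (≤-trans to≤ n*b≤)) (setReg-sim {r = 0} (same (≤-trans from≤ n*b≤)) linked)
        where
        same : ∀ {x} → x ≤ b + n * b → x + 0 ≡ word w x
        same x≤ = trans (+-identityʳ _) (sym (word-< {w} (fit x≤)))
      length≥ : n * b ≤ length text
      length≥ = ≤-reflexive (sym length-text)
      answered : ∃[ t ] ∃[ s′ ] Exec w query (ask w (i * b) (i * b + b) s₀) t s′ ×
                 reg s′ 0 ≡ modeFreq (Vec.fromList text) (i * b) (i * b + b) × Fast t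
      answered = answers s₀ reachable (i * b) (i * b + b) (≤-trans from≤ length≥) (≤-trans to≤ length≥)
      mode : ℕ
      mode = blockMode vector
      After : ℕ → State → Set
      After j s = Fixed s × reg s 9 ≡ suc j × reg s 12 ≡ i * b + b × Linked s
      n≤b : n ≤ b
      n≤b = m≤m+n n (d * n)
      1<2^w : 1 < 2 ^ w
      1<2^w = fit (≤-trans 1≤n (≤-trans n≤b (m≤m+n b _)))
      j≤ : j ≤ b + n * b
      j≤ = ≤-trans (≤-trans (n≤1+n j) (≤-trans (m≤n+m (suc j) i) (≤-reflexive i+j))) (≤-trans n≤b (m≤m+n b _))

      branch : ∀ s v → After j s → Answer i s → (v ≡ 1 × d < mode) ⊎ (v ≡ 0 × mode ≤ d) →
               Runs w (ifnz 14 (instr (const 0 1) ⨾ skip) skip) (setReg 14 v s) 2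
                    (λ s′ → After j s′ × Answer (suc i) s′)
      branch s _ (fixed , j≡ , to≡ , (s₀ , reachable , sim ρ μ)) _ (inj₁ (refl , d<)) =
        do-if-yes (λ ()) (do-const 1<2^w
          (do-skip ((fixed , j≡ , to≡ , (s₀ , reachable , sim ρ μ)) , inj₁ (refl , vector , orthogonal⇐ vector d<))))
      branch s _ (fixed , j≡ , to≡ , (s₀ , reachable , sim ρ μ)) answer (inj₂ (refl , ≤d)) =
        do-if-no refl (do-skip ((fixed , j≡ , to≡ , (s₀ , reachable , sim ρ μ)) , none answer))
        where
        none : Answer i s → Answer (suc i) s
        none (inj₁ found)          = inj₁ found
        none (inj₂ (no≡ , absent)) = inj₂ (no≡ , absent′)
          where
          absent′ : ∀ i′ → toℕ i′ < suc i → ¬ Orthogonal i′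
          absent′ i′ i′≤i orthogonal with toℕ i′ ≟ i
          ... | yes e = <⇒≱ (orthogonal⇒ i′ orthogonal)
                          (subst (_≤ d) (cong blockMode (toℕ-injective (trans vector≡ (sym e)))) ≤d)
          ... | no ≢i = absent i′ (≤∧≢⇒< (s≤s⁻¹ i′≤i) ≢i) orthogonal

      advance-runs : ∀ s → After j s → Answer (suc i) s → Runs w advance s 3 (Querying j)
      advance-runs s ((n≡ , d≡ , 1≡ , 0≡ , b≡) , j≡ , to≡ , (s₀ , reachable , sim ρ μ)) answer =
        do-add to≡ 0≡ (fit (≤-trans (≤-reflexive (+-identityʳ (i * b + b))) (≤-trans to≤ n*b≤)))
        (do-add b≡ to≡ (fit (+-monoʳ-≤ b to≤))
        (do-pred j≡ 1≡ (fit j≤)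
        (do-skip ((n≡ , d≡ , 1≡ , 0≡ , b≡) , refl , suc i , trans (sym (+-suc i j)) i+j ,
                  trans (+-identityʳ _) (+-comm (i * b) b) ,
                  trans (cong (b +_) (+-comm (i * b) b)) (+-comm b (b + i * b)) , (s₀ , reachable , sim ρ μ) , answer))))

      test-runs : ∀ s → After j s → Answer i s → reg s 20 ≡ mode → Runs w testMode s 6 (Querying j)
      test-runs s after@((_ , d≡ , _) , _) answer mode≡ =
        do-lt d≡ mode≡ 1<2^w λ v test →
        do-seq {T = 2} {T′ = 3} (branch s v after answer test) λ s′ (after′ , answer′) → advance-runs s′ after′ answer′

      after-query : ∀ {t s₂ s₃} → Exec w query (ask w (i * b) (i * b + b) s₀) t s₂ →
                    reg s₂ 0 ≡ modeFreq (Vec.fromList text) (i * b) (i * b + b) →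
                    Sim s₂ s₃ → SameLow s₁ s₃ → Runs w testMode s₃ 6 (Querying j)
      after-query {t} {s₂} {s₃} exec mode≡ linked′ same = test-runs s₃
        ((trans (same 1) n≡ , trans (same 2) d≡ , trans (same 3) 1≡ , trans (same 4) 0≡ , trans (same 11) b≡) ,
         trans (same 9) j≡ , trans (same 12) to≡ ,
         (s₂ , queried reachable (≤-trans from≤ length≥) (≤-trans to≤ length≥) exec , linked′))
        (kept answer)
        (trans (Sim.sim-reg linked′ 0) (trans mode≡ (cong (λ i → modeFreq (Vec.fromList text) (i * b) (i * b + b)) (sym vector≡))))
        where
        kept : Answer i s → Answer i s₃
        kept (inj₁ (yes≡ , pair))  = inj₁ (trans (same 0) yes≡ , pair)
        kept (inj₂ (no≡ , absent)) = inj₂ (trans (same 0) no≡ , absent)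

      query-time : ∃[ T ] Step T × Runs w (queryStep query) s T (Querying j)
      query-time =
        let t , s₂ , exec , mode≡ , fast = answered
            s₃ , exec′ , linked′ , same  = exec-sim exec asked
        in suc (suc (t + 6)) , (t , fast , trans (cong suc (sym (+-suc t 6))) (sym (+-suc t 7))) ,
           do-add from≡ 0≡ (fit (≤-trans (≤-reflexive (+-identityʳ (i * b))) (≤-trans from≤ n*b≤)))
           (do-add to≡ 0≡ (fit (≤-trans (≤-reflexive (+-identityʳ (i * b + b))) (≤-trans to≤ n*b≤)))
           (do-seq {T′ = 6} {Q = _≡ s₃} (runs exec′ ≤-refl refl) λ { _ refl → after-query exec mode≡ linked′ same }))

    queryLoop-runs : ∀ s s₀ → reg s 0 ≡ 0 → reg s 1 ≡ n → reg s 2 ≡ d → reg s 3 ≡ 1 → reg s 4 ≡ 0 → reg s 7 ≡ suc d →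
                     Reachable w (length text) build query input s₀ → Sim s₀ s →
                     ∃[ t ] Fast t × Runs w (queryLoop query) s (4 + (1 + n * (1 + (t + 8))))
                       (λ s′ → (HasOrthogonalPair A → reg s′ 0 ≡ 1) × (¬ HasOrthogonalPair A → reg s′ 0 ≡ 0))
    queryLoop-runs s s₀ out≡ n≡ d≡ 1≡ 0≡ b≡ reachable (sim ρ μ)
      with do-while′ Querying Step {T₀ = 8} (0 , fast₀ , refl) (λ _ _ → proj₁ ∘ proj₂) queryStep-runs n
             (setReg 9 (n + 0) (setReg 12 (b + 0) (setReg 10 0 (setReg 11 b s))))
             ((n≡ , d≡ , 1≡ , 0≡ , refl) , +-identityʳ n , 0 , refl , refl , +-identityʳ b ,
              (s₀ , reachable , sim ρ μ) , inj₂ (out≡ , λ _ ()))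
    ... | _ , (t , fast , refl) , loop = t , fast ,
      do-mul b≡ n≡ (fit (m≤m+n b _))
      (do-const (fit z≤n)
      (do-add refl 0≡ (fit (≤-trans (≤-reflexive (+-identityʳ b)) (m≤m+n b _)))
      (do-add n≡ 0≡ (fit (≤-trans (≤-reflexive (+-identityʳ n)) (≤-trans (m≤m+n n (d * n)) (m≤m+n b _))))
      (runs-mono ≤-refl finish loop))))
      where
      finish : ∀ s′ → Querying 0 s′ → (HasOrthogonalPair A → reg s′ 0 ≡ 1) × (¬ HasOrthogonalPair A → reg s′ 0 ≡ 0)
      finish s′ (_ , _ , i , i+0 , _ , _ , _ , inj₁ (yes≡ , pair)) = (λ _ → yes≡) , λ absent → contradiction pair absent
      finish s′ (_ , _ , i , i+0 , _ , _ , _ , inj₂ (no≡ , absent)) =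
        (λ { (i′ , pair) → contradiction pair (absent i′ (≤-trans (toℕ<n i′) (≤-reflexive (trans (sym i+0) (+-identityʳ i))))) }) ,
        λ _ → no≡

-- Degenerate machines with words of no bits

Zero : State → Set
Zero s = (∀ r → reg s r ≡ 0) × (∀ a → mem s a ≡ 0)

≔-zero : ∀ {f : ℕ → ℕ} i {v} → (∀ j → f j ≡ 0) → v ≡ 0 → ∀ j → (f [ i ≔ v ]) j ≡ 0
≔-zero i f≡0 v≡0 j with does (i ≟ j)
... | true  = v≡0
... | false = f≡0 j

op-zero : ∀ o x y → ⟦ o ⟧ 0 x y ≡ 0
op-zero add x y       = n%1≡0 (x + y)
op-zero sub x y       = n%1≡0 (1 + x ∸ y)
op-zero mul x y       = n%1≡0 (x * y)
op-zero quo x zero    = refl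
op-zero quo x (suc y) = n%1≡0 (x / suc y)
op-zero rem x zero    = refl
op-zero rem x (suc y) = n%1≡0 (x % suc y)
op-zero and x y       = refl
op-zero or  x y       = refl
op-zero xor x y       = refl
op-zero shl x y       = n%1≡0 (x * 2 ^ y)
op-zero shr x y       = n%1≡0 (_/_ x (2 ^ y) {{m^n≢0 2 y}})
op-zero eq  x y       = n%1≡0 (if does (x ≟ y) then 1 else 0)
op-zero lt  x y       = n%1≡0 (if does (x <? y) then 1 else 0)

step-zero : ∀ i {s} → Zero s → Zero (step 0 i s)
step-zero (const r v)        (ρ , μ) = ≔-zero r ρ (n%1≡0 v) , μ
step-zero (binop o r r₁ r₂)  (ρ , μ) = ≔-zero r ρ (op-zero o _ _) , μ
step-zero (read r a)         (ρ , μ) = ≔-zero r ρ (μ _) , μ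
step-zero (write a r) {s}    (ρ , μ) = ρ , ≔-zero (reg s a) μ (ρ r)

exec-zero : ∀ {P s t s′} → Exec 0 P s t s′ → Zero s → Zero s′
exec-zero skip            z = z
exec-zero (instr {i})     z = step-zero i z
exec-zero (seq e f)       z = exec-zero f (exec-zero e z)
exec-zero (if-yes _ e)    z = exec-zero e z
exec-zero (if-no _ e)     z = exec-zero e z
exec-zero (while-0 _)     z = z
exec-zero (while-s _ e f) z = exec-zero f (exec-zero e z)

-- The data structure on the grammar of an instance

numerator≥1 : ∀ {ε} → 0ℚ ℚ.< ε → 1 ≤ ∣ ↥ ε ∣
numerator≥1 {mkℚ (ℤ.+ zero)    d _} (ℚ.*<* (ℤ.+<+ ()))
numerator≥1 {mkℚ (ℤ.+ suc n)   d _} _ = s≤s z≤n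
numerator≥1 {mkℚ (ℤ.-[1+ n ])  d _} _ = s≤s z≤n

-- 1 / (2 q), where q is the denominator of ε.
half-inverse : ℚ → ℚ
half-inverse ε = mkℚ (ℤ.+ 1) (ℚ.ℚ.denominator-1 ε + suc (ℚ.ℚ.denominator-1 ε)) (1-coprimeTo _)

half-inverse-positive : ∀ ε → 0ℚ ℚ.< half-inverse ε
half-inverse-positive ε = positive⁻¹ (half-inverse ε)

module Reduction (ε κ : ℚ) (0<ε : 0ℚ ℚ.< ε) (ds : ModeFreqDataStructure ε κ) where

  open ModeFreqDataStructure ds renaming (k to kᵈ)
  open Parameters ∣ ↥ κ ∣

  Correct : ∀ {σ N} (w : ℕ) (G : SLG σ) (T : Vec (Fin σ) N) → Set
  Correct {N = N} w G T =
    (∃[ t ] ∃[ s ] Exec w build (load w (SLG.encode G)) t s ×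
       (N₀ ≤ N → t ≤ Cb * ⌊log₂ N ⌋ ^ cb · SLG.size G ^[ 2 - ε ])) ×
    (∀ s → Reachable w N build query (SLG.encode G) s → ∀ b e → b ≤ N → e ≤ N →
       ∃[ t ] ∃[ s′ ] Exec w query (ask w b e s) t s′ × reg s′ 0 ≡ modeFreq T b e ×
         (N₀ ≤ N → t ≤ Cq * ⌊log₂ N ⌋ ^ cq · SLG.size G ^[ 1 - ε ]))

  -- Makes the word size a variable, so that it can be exchanged for the closed form that `log-word`
  -- provides.
  correct-at : ∀ {σ N w} (G : SLG σ) (T : Vec (Fin σ) N) → SLG.Represents G T → LargeAlphabet κ σ N →
               wordSize kᵈ (SLG.size G + N + σ) ≡ w → Correct w G T
  correct-at G T rep large refl = correct G T rep large

  module Instance (c : ℕ) {n d L : ℕ} (2≤n : 2 ≤ n) (1≤d : 1 ≤ d) (≤n : 2 ^ L ≤ n) (n< : n < 2 ^ suc L) (d≤ : d ≤ c * suc L)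
                  (A : Vec (Vec (Fin 2) d) n) where

    module S = Sizes c {n} {d} {L} 2≤n 1≤d ≤n n< d≤
    open S using (σ; y; N; small; small≤σ; multiple)

    block≤σ : suc d * n ≤ σ
    block≤σ = small≤σ (multiple 2 (≤-trans (n≤1+n _) S.block≤))

    open Grammar A block≤σ public

    w : ℕ
    w = kᵈ * (suc (exponent c) * suc L)

    size+length≤ : SLG.size grammar + length text ≤ 30 * N
    size+length≤ = begin
      SLG.size grammar + length text ≡⟨ cong₂ _+_ size≡ length-text ⟩
      _ + N                          ≤⟨ +-monoˡ-≤ N (≤-trans S.size≤ (*-monoʳ-≤ 3 S.y≤N)) ⟩
      3 * N + N                      ≡⟨ +-comm (3 * N) N ⟩
      4 * N                          ≤⟨ *-monoˡ-≤ N (≤ᵇ⇒≤ 4 30 tt) ⟩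
      30 * N                         ∎
      where open ≤-Reasoning

    instance-correct : Correct w grammar (Vec.fromList text)
    instance-correct = correct-at grammar (Vec.fromList text) represents
      (subst (LargeAlphabet κ σ) (sym length-text) (S.large-alphabet (↧ₙ κ) (s≤s z≤n)))
      (cong (kᵈ *_) (S.log-word size+length≤))

    -- Words of no bits are constantly 0, but the mode of a nonempty range is not.
    words-have-bits : ∀ i → Orthogonal i → kᵈ ≢ 0
    words-have-bits i orthogonal k≡0 =
      let (_ , s , e , _) , answers = subst (λ w → Correct w grammar (Vec.fromList text)) (cong (_* (suc (exponent c) * suc L)) k≡0) instance-correct
          _ , _ , e′ , mode≡ , _    = answers s (built e) (toℕ i * (suc d * n)) (toℕ i * (suc d * n) + suc d * n) (≤-trans (m≤m+n _ _) to≤) to≤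
      in <⇒≢ (≤-trans (s≤s z≤n) (orthogonal⇒ i orthogonal))
             (trans (sym (proj₁ (exec-zero e′ (ask-zero (toℕ i * (suc d * n)) (toℕ i * (suc d * n) + suc d * n) (exec-zero e initial))) 0)) mode≡)
      where
      to≤ : toℕ i * (suc d * n) + suc d * n ≤ length text
      to≤ = ≤-trans (≤-reflexive (+-comm _ (suc d * n))) (≤-trans (*-monoˡ-≤ (suc d * n) (toℕ<n i)) (≤-reflexive (sym length-text)))
      initial : Zero (load 0 (SLG.encode grammar))
      initial = (λ _ → refl) , (λ a → n%1≡0 (nth (SLG.encode grammar) a))
      ask-zero : ∀ b e {s} → Zero s → Zero (ask 0 b e s)
      ask-zero b e (ρ , μ) = ≔-zero 1 (≔-zero 0 ρ (n%1≡0 b)) (n%1≡0 e) , μ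

  positive-word : 1 ≤ kᵈ
  -- Two zero vectors of dimension 1 form an instance with an orthogonal pair.
  positive-word = n≢0⇒n>0 (Instance.words-have-bits 1 {2} {1} {1} ≤-refl ≤-refl ≤-refl (≤ᵇ⇒≤ 3 4 tt) (≤ᵇ⇒≤ 1 2 tt)
    ((zero ∷ []) ∷ (zero ∷ []) ∷ []) zero (zero , refl))

-- The time bound of the last program is itself a witness depending on the state reached, so
-- `do-seq`, which wants it beforehand, does not apply.
do-main : ∀ {w P P′ Q R r s T T′} {Good : ℕ → Set} {B C D : State → Set} →
          Runs w P s T (λ s → B s × reg s r ≡ 0) →
          (∀ s → B s → Runs w Q s T′ C) →
          (∀ s → C s → ∃[ T″ ] Good T″ × Runs w R s T″ D) →
          ∃[ T″ ] Good T″ × Runs w (P ⨾ ifnz r P′ (Q ⨾ R)) s (T + (1 + (T′ + T″))) D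
do-main (runs e₁ t₁≤ (b , ≡0)) run₂ run₃ with run₂ _ b
... | runs e₂ t₂≤ c with run₃ _ c
... | T″ , good , runs e₃ t₃≤ d =
  T″ , good , runs (seq e₁ (if-no ≡0 (seq e₂ e₃))) (+-mono-≤ t₁≤ (s≤s (+-mono-≤ t₂≤ t₃≤))) d

-- The algorithm for orthogonal vectors

module Solver (ε κ : ℚ) (0<ε : 0ℚ ℚ.< ε) (ds : ModeFreqDataStructure ε κ) (c : ℕ) (1≤c : 1 ≤ c) where

  open ModeFreqDataStructure ds renaming (k to kᵈ)
  open Parameters ∣ ↥ κ ∣
  open Reduction ε κ 0<ε ds

  e k : ℕ
  e = exponent c
  k = kᵈ * suc e

  dimension : ℕ → ℕ
  dimension n = c * ⌈log₂ n ⌉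

  OVProgram : Program
  OVProgram = orthogonalVectors e build query

  -- The e multiplications of `raise` and at most 139 y other steps, rounded up.
  overhead : ℕ
  overhead = 200 + e

  module Large {n : ℕ} (2≤n : 2 ≤ n) (A : Vec (Vec (Fin 2) (dimension n)) n) where

    d L : ℕ
    d = dimension n
    L = ⌊log₂ n ⌋

    1≤n : 1 ≤ n
    1≤n = ≤-trans (s≤s z≤n) 2≤n

    1≤d : 1 ≤ d
    1≤d = *-mono-≤ 1≤c (⌈log₂⌉-mono-≤ 2≤n)

    ≤n : 2 ^ L ≤ n
    ≤n = 2^⌊log₂n⌋≤n n 1≤n

    n< : n < 2 ^ suc L
    n< = n<2^[1+⌊log₂n⌋] n

    d≤ : d ≤ c * suc L
    d≤ = *-monoʳ-≤ c (⌈log₂⌉-upper n)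

    open Instance c {n} {d} {L} 2≤n 1≤d ≤n n< d≤ A
    open S using (σ; y; N; Q; p; small; small≤σ; multiple)

    word≡ : wordSize k n ≡ w
    word≡ = *-assoc kᵈ (suc e) (suc L)

    pQ≤ : p * Q ≤ 2 ^ w
    pQ≤ = ≤-trans (≤-reflexive S.pQ≡) (^-monoʳ-≤ 2 (m≤n*m (suc e * suc L) kᵈ {{>-nonZero positive-word}}))

    D : ℕ → ℕ
    D = nth (encodeOV A)

    fits : ∀ {x} → x ≤ 30 * N → x < 2 ^ w
    fits x≤ = <-≤-trans (small x≤) (≤-trans (≤-trans (≤-reflexive (sym (*-identityˡ Q))) (*-monoˡ-≤ Q (m^n>0 2 (suc L)))) pQ≤)

    matrix : List ℕ
    matrix = concatMap bits (Vec.toList A)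

    1*y : y ≤ 1 * y
    1*y = ≤-reflexive (sym (*-identityˡ y))

    input-fits : All (_≤ 30 * N) (encodeOV A)
    input-fits = multiple 1 (≤-trans S.n≤y 1*y) All.∷
                 multiple 1 (≤-trans (n≤1+n d) (≤-trans S.suc-d≤y 1*y)) All.∷
                 All.map (λ ≤1 → multiple 1 (≤-trans ≤1 (≤-trans S.1≤y 1*y))) (matrix≤1 A)

    pad : ∀ b → 2 + n * d ≤ b → D b ≡ 0
    pad b ≤b = nth-≥ (encodeOV A) (≤-trans (≤-reflexive (cong (2 +_) (length-matrix A))) ≤b)

    open Encode w n d σ D

    X≤ : ∀ i k → i < n → k ≤ d → X i k * k ≤ k
    X≤ i zero    _ _ = ≤-reflexive (*-zeroʳ (X i 0))
    X≤ i (suc k) _ _ = ≤-trans (*-monoˡ-≤ (suc k) bit≤) (≤-reflexive (*-identityˡ (suc k)))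
      where
      bit≤ : X i (suc k) ≤ 1
      bit≤ = ≤-trans (≤-reflexive (cong (nth (d ∷ matrix)) (+-suc (i * d) k))) (nth-all (matrix≤1 A) (i * d + k))

    length-code : length code ≡ 4 + (n * 2 + (n * (1 + suc d * 2) + (suc d * (1 + n * 2) + 0)))
    length-code = cong (4 +_)
      (trans (length-++ (gather startSymbol 0 n)) (cong₂ _+_ (length-gather startSymbol (λ _ → refl) 0 n)
      (trans (length-++ (gather vectorRule 0 n)) (cong₂ _+_
        (length-gather vectorRule (λ i → cong suc (length-gather (vectorSymbol i) (λ _ → refl) 0 (suc d))) 0 n)
      (trans (length-++ (gather coordinateRule 0 (suc d))) (cong (_+ 0)
        (length-gather coordinateRule (λ k → cong suc (length-gather (coordinateSymbol k) (λ _ → refl) 0 n)) 0 (suc d))))))))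

    open Correct
      (≤-trans (s≤s (≤-reflexive (+-comm σ _))) (≤-trans (S.σ+<pQ (multiple 4 S.2+[1+n]*d≤)) pQ≤))
      (≤-trans (≤-reflexive length-code) (small≤σ (multiple 12 S.length≤)))
      (small≤σ (multiple 3 S.rules≤))
      (small≤σ (multiple 2 S.block≤))
      (≤-trans S.2+n*d≤ (≤-reflexive (sym length-code)))
      X≤

    open Setup w n d D

    2n< : n + n < 2 ^ w
    2n< = fits (multiple 2 (≤-trans (+-mono-≤ S.n≤y S.n≤y) (≤-reflexive (cong (y +_) (sym (+-identityʳ y))))))

    2<2^w : 2 < 2 ^ w
    2<2^w = ≤-<-trans (+-mono-≤ 1≤n 1≤n) 2n<

    readSizes-runs : Runs w readSizes (load w (encodeOV A)) 5 (λ s → Base s × reg s 14 ≡ 0)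
    readSizes-runs =
      do-const (≤-trans (s≤s (s≤s z≤n)) 2<2^w)
      (do-read refl (input 0) (do-read refl (input 1) (do-const 2<2^w
      (do-lt refl refl (≤-trans (s≤s (s≤s z≤n)) 2<2^w) λ
        { v (inj₁ (_ , n<2)) → contradiction 2≤n (<⇒≱ n<2)
        ; v (inj₂ (v≡0 , _)) → do-skip ((refl , refl , refl , refl , refl , (λ _ → refl) , input) , v≡0) }))))
      where
      input : ∀ a → word w (D a) ≡ D a
      input a = word-< {w} (fits (nth-all input-fits a))

    σ<2^w : σ < 2 ^ w
    σ<2^w = <-≤-trans (S.σ+<pQ {0} z≤n) pQ≤

    prepareTime : ℕ
    prepareTime = (3 + n * 5) + (1 + (e + (5 + encodeTime)))

    prepare-runs : ∀ s → Base s → Runs w (prepare e) s prepareTime (λ s′ → Env s′ × (∀ a → mem s′ a ≡ nth code a))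
    prepare-runs s base =
      do-seq (double-runs 1≤n 2n< s base) λ { s₁ (base₁@(_ , n≡ , _ , _ , 0≡ , _) , p≡) →
      do-add n≡ 0≡ (≤-<-trans (≤-trans (≤-reflexive (+-identityʳ n)) (m≤m+n n n)) 2n<)
      (do-seq (raise-runs e n p _ (m^n>0 2 (suc L)) base₁ (+-identityʳ n) p≡ σ<2^w) λ { s₂ (base₂ , σ≡) →
      do-seq (setConstants-runs constants< s₂ base₂ σ≡) λ { s₃ (env , input) →
      encodeGrammar-runs s₃ env input pad } }) }
      where
      constants< : 2 + suc n * d + suc n + suc d < 2 ^ w
      constants< = fits (multiple 7 (≤-trans (≤-reflexive (+-assoc (2 + suc n * d) (suc n) (suc d)))
        (≤-trans (+-mono-≤ S.2+[1+n]*d≤ S.rules≤) (≤-reflexive (sym (*-distribʳ-+ y 4 3))))))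

    Fast : ℕ → Set
    Fast t = N₀ ≤ length text → t ≤ Cq * ⌊log₂ length text ⌋ ^ cq · SLG.size grammar ^[ 1 - ε ]

    fast₀ : Fast 0
    fast₀ _ = z≤n

    block+N< : suc d * n + n * (suc d * n) < 2 ^ w
    block+N< = fits (≤-trans (+-monoˡ-≤ N (≤-trans (≤-reflexive (*-comm (suc d) n)) S.y≤N)) (≤-trans (≤-reflexive (cong (N +_) (sym (+-identityʳ N)))) (*-monoˡ-≤ N (≤ᵇ⇒≤ 2 30 tt))))

    BuildFast : ℕ → Set
    BuildFast t = N₀ ≤ length text → t ≤ Cb * ⌊log₂ length text ⌋ ^ cb · SLG.size grammar ^[ 2 - ε ]

    -- The time bounds hold only for texts of length at least N₀, while halting is unconditional; so
    -- the times are kept as witnesses together with their conditional bounds.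
    InTime : ℕ → Set
    InTime t = ∃[ tb ] ∃[ tq ] BuildFast tb × Fast tq × t ≡ tb + (4 + (1 + n * (1 + (tq + 8))))

    fits-code : ∀ a → nth code a < 2 ^ w
    fits-code a = ≤-<-trans {nth code a} {σ} (nth-all {σ} {code} code-fits a) σ<2^w

    Prepared Decided : State → Set
    Prepared s = Env s × (∀ a → mem s a ≡ nth code a)
    Decided s = (HasOrthogonalPair A → reg s 0 ≡ 1) × (¬ HasOrthogonalPair A → reg s 0 ≡ 0)

    initial : State
    initial = load w (SLG.encode grammar)

    prepared-sim : ∀ s → Prepared s → Sim initial s
    prepared-sim s ((_ , _ , _ , _ , _ , _ , _ , _ , _ , low≡) , code≡) = sim low≡ λ a →
      trans (code≡ a) (trans (sym (word-< {w} (fits-code a))) (cong (λ xs → word w (nth xs a)) (sym (encode≡code w))))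

    module _ {s t s₀} (prepared : Prepared s) (built-s₀ : Exec w build initial t s₀) (fast : BuildFast t) where

      queries-run : (∃[ s′ ] Exec w (shift build) s t s′ × Sim s₀ s′ × SameLow s s′) →
                    ∃[ T ] InTime T × Runs w (shift build ⨾ queryLoop query) s T Decided
      queries-run (s′ , exec , linked , same) = prepend (run prepared)
        where
        Queried : Set
        Queried = ∃[ tq ] Fast tq × Runs w (queryLoop query) s′ (4 + (1 + n * (1 + (tq + 8)))) Decided
        run : Prepared s → Queried
        run ((out≡ , n≡ , d≡ , 1≡ , 0≡ , _ , b≡ , _) , _) =
          Queries.queryLoop-runs {w} {n} {d} {σ} {A} block≤σ {build} {query} {SLG.encode grammar}
            Fast fast₀ (proj₂ instance-correct) 1≤n block+N< s′ s₀
            (trans (same 0) out≡) (trans (same 1) n≡) (trans (same 2) d≡) (trans (same 3) 1≡) (trans (same 4) 0≡) (trans (same 7) b≡)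
            (built built-s₀) linked
        prepend : Queried → ∃[ T ] InTime T × Runs w (shift build ⨾ queryLoop query) s T Decided
        prepend (tq , fast′ , runs e t≤ q) = _ , (t , tq , fast , fast′ , refl) , runs (seq exec e) (+-monoʳ-≤ t t≤) q

    build-and-query : (∃[ t ] ∃[ s ] Exec w build initial t s × BuildFast t) →
                      ∀ s → Prepared s → ∃[ T ] InTime T × Runs w (shift build ⨾ queryLoop query) s T Decided
    build-and-query (t , s₀ , e , fast) s prepared = queries-run prepared e fast (exec-sim e (prepared-sim s prepared))

    solved : ∃[ T ] InTime T × Runs w OVProgram (load w (encodeOV A)) (5 + (1 + (prepareTime + T))) Decided
    solved = do-main readSizes-runs prepare-runs (build-and-query (proj₁ instance-correct))

    total-overhead : ∀ b t → 5 + (1 + (prepareTime + (b + (4 + (1 + n * (1 + (t + 8))))))) ≤ overhead * (n * suc d) + b + n * t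
    total-overhead b t = begin
      5 + (1 + (prepareTime + (b + (4 + (1 + n * (1 + (t + 8)))))))    ≡⟨ expand n (suc d) (2 + n * d) e b t ⟩
      46 * 1 + 29 * n + 24 * y + 10 * suc d + 10 * (2 + n * d) + e * 1 + b + n * t ≤⟨ +-monoˡ-≤ (n * t) (+-monoˡ-≤ b
        (+-mono-≤ (+-mono-≤ (+-mono-≤ (+-monoˡ-≤ (24 * y) (+-mono-≤ (*-monoʳ-≤ 46 S.1≤y) (*-monoʳ-≤ 29 S.n≤y)))
           (*-monoʳ-≤ 10 S.suc-d≤y)) (*-monoʳ-≤ 10 total≤3y)) (*-monoʳ-≤ e S.1≤y))) ⟩
      46 * y + 29 * y + 24 * y + 10 * y + 10 * (3 * y) + e * y + b + n * t ≡⟨ cong (λ a → a + b + n * t) (collect e y) ⟩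
      (139 + e) * y + b + n * t                                        ≤⟨ +-monoˡ-≤ (n * t) (+-monoˡ-≤ b (*-monoˡ-≤ y (+-monoˡ-≤ e (≤ᵇ⇒≤ 139 200 tt)))) ⟩
      overhead * y + b + n * t                                         ∎
      where
      open ≤-Reasoning
      total≤3y : 2 + n * d ≤ 3 * y
      total≤3y = ≤-trans (+-mono-≤ (*-monoʳ-≤ 2 S.1≤y) (*-monoʳ-≤ n (n≤1+n d))) (≤-reflexive (+-comm (2 * y) y))
      expand : ∀ n v g e b t →
        5 + (1 + (((3 + n * 5) + (1 + (e + (5 + ((4 + g * 6) + (10 + ((3 + n * 7) +
                 ((3 + n * (5 + ((1 + v * 11) + 2))) + ((3 + v * (7 + ((1 + n * 13) + 2))) + (3 + g * 4)))))))))) + (b + (4 + (1 + n * (1 + (t + 8)))))))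
        ≡ 46 * 1 + 29 * n + 24 * (n * v) + 10 * v + 10 * g + e * 1 + b + n * t
      expand = solve-∀
      collect : ∀ e y → 46 * y + 29 * y + 24 * y + 10 * y + 10 * (3 * y) + e * y ≡ (139 + e) * y
      collect = solve-∀

    n≤length : n ≤ length text
    n≤length = ≤-trans S.n≤y (≤-trans S.y≤N (≤-reflexive (sym length-text)))

  module Small {n : ℕ} (n<2 : n < 2) where

    w : ℕ
    w = wordSize k n

    2≤w : 2 ≤ w
    -- The factor e + 1 in `k` alone is at least 2, which makes room for the few constants used when
    -- n < 2.
    2≤w = *-mono-≤ (*-mono-≤ positive-word (s≤s (m≤n+m 1 (surplus c + 2) ∙ ≤-reflexive (+-assoc (surplus c) 2 1)))) (s≤s (z≤n {⌊log₂ n ⌋}))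
      where
      _∙_ : ∀ {i j k} → i ≤ j → j ≤ k → i ≤ k
      _∙_ = ≤-trans

    fits : ∀ {x} → x ≤ 3 → x < 2 ^ w
    fits x≤3 = ≤-trans (s≤s x≤3) (^-monoʳ-≤ 2 2≤w)

    n≡word : word w n ≡ n
    n≡word = word-< {w} (fits (≤-trans (<⇒≤ n<2) (s≤s (s≤s z≤n))))

    copy-n : (A : Vec (Vec (Fin 2) (dimension n)) n) →
             Runs w OVProgram (load w (encodeOV A)) 7 (λ s → reg s 0 ≡ n)
    copy-n A = do-seq {T = 5} {T′ = 2}
      (do-const (fits (s≤s z≤n)) (do-read refl n≡word (do-read refl refl (do-const (fits (s≤s (s≤s z≤n)))
        (do-lt refl refl (fits (s≤s z≤n)) λ
          { v (inj₁ (v≡1 , _)) → do-skip {Q = λ s → reg s 1 ≡ n × reg s 4 ≡ 0 × reg s 14 ≡ 1} (refl , refl , v≡1)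
          ; v (inj₂ (_ , 2≤n)) → contradiction n<2 (≤⇒≯ 2≤n) })))))
      λ { s (n≡ , 0≡ , test) → do-if-yes (λ ≡0 → case trans (sym test) ≡0 of λ ())
        (do-add n≡ 0≡ (fits (≤-trans (≤-reflexive (+-identityʳ n)) (≤-trans (<⇒≤ n<2) (s≤s (s≤s z≤n)))))
        (do-skip (+-identityʳ n))) }

  -- For n = 1 the dimension c ⌈log 1⌉ is 0, and the empty vector is orthogonal to itself; so the
  -- answer is n.
  solves-small : ∀ n (A : Vec (Vec (Fin 2) (dimension n)) n) → n < 2 →
                 (HasOrthogonalPair A → n ≡ 1) × (¬ HasOrthogonalPair A → n ≡ 0)
  solves-small zero                A       _   = (λ { (() , _) }) , λ _ → refl
  solves-small (suc zero)          (x ∷ []) _  = (λ _ → refl) , λ absent → contradiction (zero , zero , dot≡0⇐ x x λ k → contradiction (toℕ<n k) (subst (λ d → toℕ k ≮ d) (sym (*-zeroʳ c)) λ ())) absent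
  solves-small (suc (suc n))       A (s≤s (s≤s ()))

  module T = Time c overhead Cb cb Cq cq

  -- The threshold N₀ carries over because the text is at least as long as n; the 2 exempts the
  -- trivial instances from the time bound. The word size is a parameter so that `word≡` can be
  -- substituted.
  Solution : ∀ n → Vec (Vec (Fin 2) (dimension n)) n → ℕ → Set
  Solution n A w = ∃[ t ] ∃[ s ] Exec w OVProgram (load w (encodeOV A)) t s ×
    (HasOrthogonalPair A → reg s 0 ≡ 1) × (¬ HasOrthogonalPair A → reg s 0 ≡ 0) ×
    (N₀ ⊔ 2 ≤ n → t ≤ T.constant (↧ₙ ε) · n ^[ 2 - half-inverse ε ])

  solution-small : ∀ {n} → n < 2 → (A : Vec (Vec (Fin 2) (dimension n)) n) → Solution n A (wordSize k n)
  solution-small {n} n<2 A = convert (Small.copy-n n<2 A)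
    where
    convert : Runs (wordSize k n) OVProgram (load (wordSize k n) (encodeOV A)) 7 (λ s → reg s 0 ≡ n) → Solution n A (wordSize k n)
    convert (runs exec _ out≡) = _ , _ , exec ,
      (λ pair → trans out≡ (proj₁ (solves-small n A n<2) pair)) ,
      (λ absent → trans out≡ (proj₂ (solves-small n A n<2) absent)) ,
      λ n₀≤n → contradiction (≤-trans (m≤n⊔m N₀ 2) n₀≤n) (<⇒≱ n<2)

  solution-large : ∀ {n} → 2 ≤ n → (A : Vec (Vec (Fin 2) (dimension n)) n) → Solution n A (wordSize k n)
  solution-large {n} 2≤n A = subst (Solution n A) (sym word≡) (convert solved)
    where
    open Large 2≤n A
    open Instance c {n} {d} {L} 2≤n 1≤d ≤n n< d≤ A
    N₀≤ : N₀ ⊔ 2 ≤ n → N₀ ≤ length text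
    N₀≤ n₀≤n = ≤-trans (≤-trans (m≤m⊔n N₀ 2) n₀≤n) n≤length
    convert : (∃[ t ] InTime t × Runs w OVProgram (load w (encodeOV A)) (5 + (1 + (prepareTime + t))) Decided) → Solution n A w
    convert (_ , (t₁ , t₂ , fast₁ , fast₂ , refl) , runs {t} exec t≤ (found , absent)) = _ , _ , exec , found , absent , λ n₀≤n →
      T.total-time {n} {d} {L} {↧ₙ ε} {∣ ↥ ε ∣} {SLG.size grammar} {⌊log₂ length text ⌋} {t} {t₁} {t₂}
        (s≤s z≤n) (numerator≥1 0<ε) 1≤n ≤n d≤
        (≤-trans (≤-reflexive (cong ⌊log₂_⌋ length-text)) S.log-N≤)
        (≤-trans S.n≤size (≤-reflexive (sym size≡))) (≤-trans (≤-reflexive size≡) S.size≤)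
        (fast₁ (N₀≤ n₀≤n)) (fast₂ (N₀≤ n₀≤n))
        (≤-trans t≤ (total-overhead t₁ t₂))

  solvable : OVSolvable (half-inverse ε) c
  solvable = record
    { program = OVProgram
    ; k       = k
    ; C       = T.constant (↧ₙ ε)
    ; n₀      = N₀ ⊔ 2
    ; solves  = λ n A _ → by-size n A (n <? 2)
    }
    where
    by-size : ∀ n A → Dec (n < 2) → Solution n A (wordSize k n)
    by-size n A (yes n<2) = solution-small n<2 A
    by-size n A (no n≮2)  = solution-large (≮⇒≥ n≮2) A

corollary1p10 : OrthogonalVectorsConjecture →
    (ε : ℚ) → 0ℚ ℚ.< ε →
    (κ : ℚ) → 0ℚ ℚ.< κ →
    ¬ ModeFreqDataStructure ε κ
corollary1p10 ovc ε 0<ε κ _ ds with c , 1≤c , ¬solvable ← ovc (half-inverse ε) (half-inverse-positive ε) =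
  ¬solvable (Solver.solvable ε κ 0<ε ds c 1≤c)
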